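{- Let $C_{p,q}$ be the annulus with $p$ marked points on the outer and $q$ on the inner boundary, $T$ its fan triangulation, $Q$ the adjacency quiver of $T$ (a source-sink orientation of the $(p+q)$-cycle, with source and sink $s,t$), and $c$ the core curve, and let $t_c$ denote the Dehn twist along $c$. Then: (1) an arc $\gamma$ (essential, not in $T$) is bridging if and only if $M_\gamma$ is transjective, and peripheral if and only if $M_\gamma$ is regular; equivalently $$i(\gamma,c)=\bigl|\partial(\underline{\dim}\,M_\gamma)\bigr|\in\{0,1\};$$ (2) $t_c$ fixes every peripheral arc; for a bridging arc $\gamma$, each coordinate of $k\mapsto\underline{\dim}\,M_{t_c^{\,k}\gamma}$ ($k\in\mathbb{Z}$) is a $V$-shaped sequence of slopes $\mp1$ (possibly with a flat bottom), on each of the two arms of the orbit consecutive twists eventually add exactly $\delta$, and the two arms carry constant defect $+1$ and $-1$, respectively; (3) consequently, for the projection $\pi_{st}$ of $C(Q)$: the two off-diagonal lines $c_s-c_t=\pm1$ carry the bridging arcs, separated by the sign of the defect (the two arms of the twist orbits), and along each arm the Dehn twist realizes the $\delta$-shift filling the line; the diagonal $c_s=c_t$ carries only the finitely many arcs disjoint from the core.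
   Context: $Q$ is an acyclic quiver of type $\widetilde A_n$, $n+1=p+q$, with null root $\delta=(1,\dots,1)$. $C(Q)\subset\mathbb{Z}^{Q_0}$ denotes the set of all $c$-vectors of the cluster algebra with principal coefficients at the seed associated with $Q$; it is known that $C(Q)=\{\pm\beta:\beta\text{ the dimension vector of an exceptional (rigid, indecomposable) }kQ\text{ -module}\}$, $k$ algebraically closed. $\pi_{st}(x)=(x_s,x_t)$. The defect is $\partial(x)=\langle\delta,x\rangle$ with Euler form $\langle x,y\rangle=\sum_i x_iy_i-\sum_{i\to j}x_iy_j$; here $\partial(x)=x_s-x_t$. An indecomposable module is preprojective, regular, preinjective according as the defect of its dimension vector is $<0,=0,>0$; transjective means preprojective or preinjective. Surface model. In the universal cover of $C_{p,q}$, identify the outer marked points with $\mathbb{Z}$ (reduction mod $p$) and the inner marked points with $\mathbb{Z}$ (reduction mod $q$), the deck transformation acting by $(a,b)\mapsto(a+p,b+q)$. An arc is bridging if it joins the two boundary components and peripheral otherwise. A bridging arc is determined by an endpoint pair $(a,b)$ up to the deck action, and two bridging arcs have minimal crossing number $i((a,b),(a',b'))=\#\{k\in\mathbb{Z}:(a-a'-kp)(b-b'-kq)<0\}$; in general $i(\cdot,\cdot)$ is the minimal (geometric) crossing number up to isotopy. The Dehn twist acts on bridging arcs by $(a,b)\mapsto(a+p,b)$. The fan triangulation $T$ consists of the bridging arcs $(j,0)$ for $0\le j\le p$ and $(p,j)$ for $1\le j\le q-1$; its adjacency quiver $Q$ is the source-sink orientation of the $(n+1)$-cycle (unique source, unique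 sink), with $s$ and $t$ the two arcs $(0,0)$ and $(p,0)$ shared by the outer and inner fans. Write $\tau_i$ for the arc of $T$ corresponding to $i\in Q_0$. Standard dictionary (taken as known): $\gamma\mapsto M_\gamma$, where $(\underline{\dim}\,M_\gamma)_i=i(\gamma,\tau_i)$, is a bijection between the essential arcs of $C_{p,q}$ not in $T$ and the exceptional indecomposable $kQ$-modules; an arc "carried" by a line of $\pi_{st}$ is one whose dimension vector $\underline{\dim}\,M_\gamma$ projects to that line. In (2), $\underline{\dim}\,M_{t_c^k\gamma}$ is understood as the vector of crossing numbers $(i(t_c^k\gamma,\tau_i))_i$ (equal to $0$ when $t_c^k\gamma\in T$); a $V$-shaped sequence of slopes $\mp1$ possibly with a flat bottom is one that decreases by $1$ per step, then is constant on a possibly trivial finite stretch, then increases by $1$ per step; the two arms of the orbit are its two ends, $k$ sufficiently large positive and $k$ sufficiently large negative ("add $\delta$" being per twist moving outward along the arm). -}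

module Defs where

open import Level using (Level; _⊔_)
open import Data.Bool using (if_then_else_)
open import Data.Nat as ℕ using (ℕ; zero; suc; NonZero)
open import Data.Nat.DivMod using (_mod_)
import Data.Nat.DivMod as DivMod
import Data.Nat.Properties as ℕₚ
open import Data.Integer as ℤ using (ℤ; +_; -[1+_]; 0ℤ; 1ℤ; -1ℤ; ∣_∣)
import Data.Integer.Properties as ℤₚ
open import Data.Integer.Tactic.RingSolver using (solve-∀)
open import Data.Fin as Fin using (Fin; toℕ; splitAt)
import Data.Fin.Properties as Finₚ
open import Data.Sum using (_⊎_; inj₁; inj₂; [_,_]′)
open import Data.Product using (Σ; ∃; _×_; _,_)
open import Data.Unit using (⊤)
open import Data.Empty using (⊥)
open import Data.List using (List; map; filter; foldl; length; upTo)
open import Data.List.Membership.Propositional using (_∈_)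
open import Data.List.Membership.Propositional.Properties using (∈-map⁺; ∈-upTo⁺)
open import Function using (_∘_; _⇔_)
open import Relation.Nullary using (¬_; Dec; does; yes; no; contradiction)
open import Relation.Binary.PropositionalEquality
  using (_≡_; _≗_; refl; sym; trans; cong; cong₂; subst; module ≡-Reasoning)
import Algebra.Definitions.RawMonoid as RawMonoidSum
import Algebra.Definitions.RawSemiring as RawSemiringPower
open import Algebra.Bundles using (CommutativeRing; Semiring)
open import Algebra.Apartness.Bundles using (HeytingField; HeytingCommutativeRing)

sumℤ : ∀ {n} → (Fin n → ℤ) → ℤ
sumℤ = RawMonoidSum.sum ℤ.+-0-rawMonoid

-- Vertices Fin V, arrows Fin E, arrow α going from src α to tgt α.
record Quiver : Set where
  field
    V E     : ℕ
    src tgt : Fin E → Fin V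

module _ (Q : Quiver) where
  open Quiver Q

  euler : (Fin V → ℤ) → (Fin V → ℤ) → ℤ
  euler x y = sumℤ (λ i → x i ℤ.* y i) ℤ.- sumℤ (λ α → x (src α) ℤ.* y (tgt α))

  arrows : Fin V → Fin V → ℤ
  arrows i j =
    sumℤ (λ α → if does (src α Fin.≟ i) then (if does (tgt α Fin.≟ j) then 1ℤ else 0ℤ) else 0ℤ)

  exchangeMatrix : Fin V → Fin V → ℤ
  exchangeMatrix i j = arrows i j ℤ.- arrows j i

-- The matrices B and C of a seed: the extended exchange matrix has B as its
-- mutable rows and C as its frozen rows, so the c-vectors are the columns of C.
record Seed (n : ℕ) : Set where
  constructor seed
  field
    B C : Fin n → Fin n → ℤ

pos neg : ℤ → ℤ
pos x = x ℤ.⊔ 0ℤ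
neg x = (ℤ.- x) ℤ.⊔ 0ℤ

mutate : ∀ {n} → Seed n → Fin n → Seed n
mutate (seed B C) k = seed
  (λ i j → if does (i Fin.≟ k) then ℤ.- B i j else entry B i j)
  (entry C)
  where
  entry : (Fin _ → Fin _ → ℤ) → Fin _ → Fin _ → ℤ
  entry A i j = if does (j Fin.≟ k) then ℤ.- A i j else
    A i j ℤ.+ pos (A i k) ℤ.* pos (B k j) ℤ.- neg (A i k) ℤ.* neg (B k j)

initialSeed : (Q : Quiver) → Seed (Quiver.V Q)
initialSeed Q = seed (exchangeMatrix Q) (λ i j → if does (i Fin.≟ j) then 1ℤ else 0ℤ)

IsCVector : (Q : Quiver) → (Fin (Quiver.V Q) → ℤ) → Set
IsCVector Q x = ∃ λ ks → ∃ λ j → ∀ i → x i ≡ Seed.C (foldl mutate (initialSeed Q) ks) i j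

fieldRing : ∀ {c ℓ₁ ℓ₂} → HeytingField c ℓ₁ ℓ₂ → CommutativeRing c ℓ₁
fieldRing K = HeytingCommutativeRing.commutativeRing (HeytingField.heytingCommutativeRing K)

-- Every monic polynomial of positive degree has a root.
AlgebraicallyClosed : ∀ {c ℓ₁ ℓ₂} → HeytingField c ℓ₁ ℓ₂ → Set (c ⊔ ℓ₁)
AlgebraicallyClosed K =
  ∀ n (a : Fin (suc n) → Carrier) →
  ∃ λ x → x ^ suc n + sum (λ i → a i * x ^ toℕ i) ≈ 0#
  where
  open CommutativeRing (fieldRing K)
  open RawMonoidSum +-rawMonoid using (sum)
  open RawSemiringPower (Semiring.rawSemiring semiring) using (_^_)

module Representations {c ℓ₁ ℓ₂ : Level} (K : HeytingField c ℓ₁ ℓ₂) (Q : Quiver) where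
  open CommutativeRing (fieldRing K)
  open RawMonoidSum +-rawMonoid using (sum)
  open Quiver Q

  Mat : ℕ → ℕ → Set c
  Mat m n = Fin m → Fin n → Carrier

  infix  4 _≈ᴹ_
  infixl 7 _∙_

  _≈ᴹ_ : ∀ {m n} → Mat m n → Mat m n → Set ℓ₁
  A ≈ᴹ A' = ∀ i j → A i j ≈ A' i j

  _∙_ : ∀ {l m n} → Mat l m → Mat m n → Mat l n
  (A ∙ A') i j = sum (λ h → A i h * A' h j)

  1ᴹ : ∀ {n} → Mat n n
  1ᴹ i j = if does (i Fin.≟ j) then 1# else 0#

  blockDiagonal : ∀ {m m' n n'} → Mat m n → Mat m' n' → Mat (m ℕ.+ m') (n ℕ.+ n')
  blockDiagonal {m} {m'} {n} {n'} A A' i j = entry (splitAt m i) (splitAt n j)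
    where
    entry : Fin m ⊎ Fin m' → Fin n ⊎ Fin n' → Carrier
    entry (inj₁ i) (inj₁ j) = A i j
    entry (inj₂ i) (inj₂ j) = A' i j
    entry _        _        = 0#

  Vect : ℕ → Set c
  Vect n = Fin n → Carrier

  infix 4 _≈ⱽ_

  _≈ⱽ_ : ∀ {n} → Vect n → Vect n → Set ℓ₁
  v ≈ⱽ w = ∀ i → v i ≈ w i

  0ⱽ : ∀ {n} → Vect n
  0ⱽ _ = 0#

  _·_ : ∀ {m n} → Mat m n → Vect n → Vect m
  (A · v) i = sum (λ j → A i j * v j)

  -- A finite-dimensional kQ-module, as the representation with space
  -- k^(dim i) at the vertex i.
  record Rep : Set c where
    field
      dim : Fin V → ℕ
      act : ∀ α → Mat (dim (tgt α)) (dim (src α))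
  open Rep public

  dimVec : Rep → Fin V → ℤ
  dimVec M i = + dim M i

  record Hom (M N : Rep) : Set (c ⊔ ℓ₁) where
    field
      at      : ∀ i → Mat (dim N i) (dim M i)
      commute : ∀ α → at (tgt α) ∙ act M α ≈ᴹ act N α ∙ at (src α)
  open Hom public

  infix 4 _≅_

  -- The field same-dim is redundant: it follows from the existence of mutually
  -- inverse matrices over a field.
  record _≅_ (M N : Rep) : Set (c ⊔ ℓ₁) where
    field
      to       : Hom M N
      from     : Hom N M
      from∘to  : ∀ i → at from i ∙ at to i ≈ᴹ 1ᴹ
      to∘from  : ∀ i → at to i ∙ at from i ≈ᴹ 1ᴹ
      same-dim : ∀ i → dim M i ≡ dim N i

  _⊕_ : Rep → Rep → Rep
  M ⊕ N = record
    { dim = λ i → dim M i ℕ.+ dim N i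
    ; act = λ α → blockDiagonal (act M α) (act N α)
    }

  IsZero : Rep → Set
  IsZero M = ∀ i → dim M i ≡ 0

  Indecomposable : Rep → Set (c ⊔ ℓ₁)
  Indecomposable M = ¬ IsZero M × (∀ N N' → M ≅ N ⊕ N' → IsZero N ⊎ IsZero N')

  record ShortExact (M E N : Rep) : Set (c ⊔ ℓ₁) where
    field
      mono   : Hom M E
      epi    : Hom E N
      inj    : ∀ i v → at mono i · v ≈ⱽ 0ⱽ → v ≈ⱽ 0ⱽ
      surj   : ∀ i w → ∃ λ v → at epi i · v ≈ⱽ w
      middle : ∀ i v → (at epi i · v ≈ⱽ 0ⱽ) ⇔ (∃ λ u → at mono i · u ≈ⱽ v)

  Splits : ∀ {M E N} → ShortExact M E N → Set (c ⊔ ℓ₁)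
  Splits {M} {E} S =
    Σ (Hom E M) λ r → ∀ i → at r i ∙ at (ShortExact.mono S) i ≈ᴹ 1ᴹ

  -- Ext¹(M , M) = 0: every self-extension splits.
  Rigid : Rep → Set (c ⊔ ℓ₁)
  Rigid M = ∀ E (S : ShortExact M E M) → Splits S

  Exceptional : Rep → Set (c ⊔ ℓ₁)
  Exceptional M = Rigid M × Indecomposable M

-- A marked point of the universal cover, a strip.
data Point : Set where
  outer inner : ℤ → Point

module Annulus (p q : ℕ) .{{_ : NonZero p}} .{{_ : NonZero q}} where

  -- An essential arc, given by a lift to the strip: its isotopy class is
  -- determined by the end points of the lift.  The lift of a peripheral arc
  -- joins a to a + l; it projects to a simple arc iff l ≤ p (resp. l ≤ q), the
  -- two ends coinciding in the annulus when equality holds, and it is isotopic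
  -- into the boundary iff l = 1.
  data Arc : Set where
    bridging        : (a b : ℤ) → Arc
    peripheralOuter : (a : ℤ) (l : ℕ) → 2 ℕ.≤ l → l ℕ.≤ p → Arc
    peripheralInner : (b : ℤ) (l : ℕ) → 2 ℕ.≤ l → l ℕ.≤ q → Arc

  Bridging Peripheral : Arc → Set
  Bridging (bridging _ _) = ⊤
  Bridging _              = ⊥
  Peripheral γ = ¬ Bridging γ

  end₁ end₂ : Arc → Point
  end₁ (bridging a b)            = outer a
  end₁ (peripheralOuter a l _ _) = outer a
  end₁ (peripheralInner b l _ _) = inner b
  end₂ (bridging a b)            = inner b
  end₂ (peripheralOuter a l _ _) = outer (a ℤ.+ + l)
  end₂ (peripheralInner b l _ _) = inner (b ℤ.+ + l)

  -- The k-th power of the generator of the deck group.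
  deck : ℤ → Arc → Arc
  deck k (bridging a b)              = bridging (a ℤ.+ k ℤ.* + p) (b ℤ.+ k ℤ.* + q)
  deck k (peripheralOuter a l 2≤l l≤p) = peripheralOuter (a ℤ.+ k ℤ.* + p) l 2≤l l≤p
  deck k (peripheralInner b l 2≤l l≤q) = peripheralInner (b ℤ.+ k ℤ.* + q) l 2≤l l≤q

  infix 4 _≈_

  _≈_ : Arc → Arc → Set
  γ ≈ γ' = ∃ λ k → deck k γ ≡ γ'

  -- The k-th power of the Dehn twist, lifted to the strip so that it translates
  -- the outer boundary line by k p and fixes the inner one.
  twist^ : ℤ → Arc → Arc
  twist^ k (bridging a b)                = bridging (a ℤ.+ k ℤ.* + p) b
  twist^ k (peripheralOuter a l 2≤l l≤p) = peripheralOuter (a ℤ.+ k ℤ.* + p) l 2≤l l≤p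
  twist^ k (peripheralInner b l 2≤l l≤q) = peripheralInner b l 2≤l l≤q

  twist : Arc → Arc
  twist = twist^ 1ℤ

  twist^-+ : ∀ k j γ → twist^ (k ℤ.+ j) γ ≡ twist^ k (twist^ j γ)
  twist^-+ k j γ = go γ
    where
    eq : ∀ a k j r → a ℤ.+ (k ℤ.+ j) ℤ.* r ≡ a ℤ.+ j ℤ.* r ℤ.+ k ℤ.* r
    eq = solve-∀
    go : ∀ γ → twist^ (k ℤ.+ j) γ ≡ twist^ k (twist^ j γ)
    go (bridging a b)            = cong (λ x → bridging x b) (eq a k j (+ p))
    go (peripheralOuter a l m n) = cong (λ x → peripheralOuter x l m n) (eq a k j (+ p))
    go (peripheralInner b l m n) = refl

  -- A lifted arc separates the strip; the sign of side γ x tells on which side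
  -- the marked point x lies (0: x is an end point of γ).
  side : Arc → Point → ℤ
  side (bridging a b)            (outer x) = a ℤ.- x
  side (bridging a b)            (inner y) = b ℤ.- y
  side (peripheralOuter a l _ _) (outer x) = (a ℤ.- x) ℤ.* (a ℤ.+ + l ℤ.- x)
  side (peripheralOuter a l _ _) (inner _) = 1ℤ
  side (peripheralInner b l _ _) (outer _) = 1ℤ
  side (peripheralInner b l _ _) (inner y) = (b ℤ.- y) ℤ.* (b ℤ.+ + l ℤ.- y)

  -- The lift of the core curve is the middle line of the strip.
  sideOfCore : Point → ℤ
  sideOfCore (outer _) = 1ℤ
  sideOfCore (inner _) = -1ℤ

  -- Two lifted arcs in minimal position cross, and then exactly once, iff the
  -- ends of one lie on different sides of the other.  For bridging arcs and
  -- the lift deck k (bridging a' b') of the second one this is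
  -- (a - (a' + k p)) (b - (b' + k q)) < 0.
  Crosses : Arc → Arc → Set
  Crosses γ γ' = side γ (end₁ γ') ℤ.* side γ (end₂ γ') ℤ.< 0ℤ

  crosses? : ∀ γ γ' → Dec (Crosses γ γ')
  crosses? γ γ' = side γ (end₁ γ') ℤ.* side γ (end₂ γ') ℤₚ.<? 0ℤ

  coord : Point → ℤ
  coord (outer x) = x
  coord (inner y) = y

  size : Arc → ℕ
  size γ = ∣ coord (end₁ γ) ∣ ℕ.+ ∣ coord (end₂ γ) ∣

  -- The integers from -N to N.
  interval : ℕ → List ℤ
  interval N = map (λ j → + j ℤ.- + N) (upTo (suc (N ℕ.+ N)))

  -- The number of k ∈ ℤ such that deck k γ' crosses γ; that no such k lies
  -- outside the interval is crossings-in-interval below.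
  i⟨_,_⟩ : Arc → Arc → ℕ
  i⟨ γ , γ' ⟩ = length (filter (λ k → crosses? γ (deck k γ')) (interval (size γ ℕ.+ size γ')))

  -- The core curve has a single lift.
  i⟨_,core⟩ : Arc → ℕ
  i⟨ γ ,core⟩ = if does (sideOfCore (end₁ γ) ℤ.* sideOfCore (end₂ γ) ℤₚ.<? 0ℤ) then 1 else 0

  private
    <0⇒¬>0 : ∀ {x} → x ℤ.< 0ℤ → ¬ (0ℤ ℤ.< x)
    <0⇒¬>0 x<0 0<x = ℤₚ.<-irrefl refl (ℤₚ.<-trans x<0 0<x)

    pos*pos : ∀ {x y} → 0ℤ ℤ.< x → 0ℤ ℤ.< y → 0ℤ ℤ.< x ℤ.* y
    pos*pos {x} {y} 0<x 0<y =
      subst (ℤ._< x ℤ.* y) (ℤₚ.*-zeroʳ x) (ℤₚ.*-monoˡ-<-pos x {{ℤ.positive 0<x}} 0<y)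

    neg*neg : ∀ {x y} → x ℤ.< 0ℤ → y ℤ.< 0ℤ → 0ℤ ℤ.< x ℤ.* y
    neg*neg {x} {y} x<0 y<0 =
      subst (ℤ._< x ℤ.* y) (ℤₚ.*-zeroʳ x) (ℤₚ.*-monoˡ-<-neg x {{ℤ.negative x<0}} y<0)

    Below Above : Arc → Point → Set
    Below γ e = coord (end₁ γ) ℤ.< coord e × coord (end₂ γ) ℤ.< coord e
    Above γ e = coord e ℤ.< coord (end₁ γ) × coord e ℤ.< coord (end₂ γ)

    i<j⇒i-j<0 : ∀ {i j} → i ℤ.< j → i ℤ.- j ℤ.< 0ℤ
    i<j⇒i-j<0 {i} {j} i<j = subst (i ℤ.- j ℤ.<_) (ℤₚ.+-inverseʳ j) (ℤₚ.+-monoˡ-< (ℤ.- j) i<j)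

    j<i⇒0<i-j : ∀ {i j} → j ℤ.< i → 0ℤ ℤ.< i ℤ.- j
    j<i⇒0<i-j {i} {j} j<i = subst (ℤ._< i ℤ.- j) (ℤₚ.+-inverseʳ j) (ℤₚ.+-monoˡ-< (ℤ.- j) j<i)

    sameSide-below : ∀ γ e e' → Below γ e → Below γ e' → 0ℤ ℤ.< side γ e ℤ.* side γ e'
    sameSide-below γ e e' be be' = go γ e e' be be'
      where
      br : ∀ a b e → Below (bridging a b) e → side (bridging a b) e ℤ.< 0ℤ
      br a b (outer x) (u , _) = i<j⇒i-j<0 u
      br a b (inner y) (_ , v) = i<j⇒i-j<0 v
      po : ∀ a l m n e → Below (peripheralOuter a l m n) e → 0ℤ ℤ.< side (peripheralOuter a l m n) e
      po a l m n (outer x) (u , v) = neg*neg (i<j⇒i-j<0 u) (i<j⇒i-j<0 v)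
      po a l m n (inner y) _ = ℤ.+<+ ℕ.z<s
      pi : ∀ a l m n e → Below (peripheralInner a l m n) e → 0ℤ ℤ.< side (peripheralInner a l m n) e
      pi a l m n (inner x) (u , v) = neg*neg (i<j⇒i-j<0 u) (i<j⇒i-j<0 v)
      pi a l m n (outer y) _ = ℤ.+<+ ℕ.z<s
      go : ∀ γ e e' → Below γ e → Below γ e' → 0ℤ ℤ.< side γ e ℤ.* side γ e'
      go (bridging a b) e e' x y = neg*neg (br a b e x) (br a b e' y)
      go (peripheralOuter a l m n) e e' x y = pos*pos (po a l m n e x) (po a l m n e' y)
      go (peripheralInner a l m n) e e' x y = pos*pos (pi a l m n e x) (pi a l m n e' y)

    sameSide-above : ∀ γ e e' → Above γ e → Above γ e' → 0ℤ ℤ.< side γ e ℤ.* side γ e'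
    sameSide-above γ e e' be be' = go γ e e' be be'
      where
      br : ∀ a b e → Above (bridging a b) e → 0ℤ ℤ.< side (bridging a b) e
      br a b (outer x) (u , _) = j<i⇒0<i-j u
      br a b (inner y) (_ , v) = j<i⇒0<i-j v
      po : ∀ a l m n e → Above (peripheralOuter a l m n) e → 0ℤ ℤ.< side (peripheralOuter a l m n) e
      po a l m n (outer x) (u , v) = pos*pos (j<i⇒0<i-j u) (j<i⇒0<i-j v)
      po a l m n (inner y) _ = ℤ.+<+ ℕ.z<s
      pi : ∀ a l m n e → Above (peripheralInner a l m n) e → 0ℤ ℤ.< side (peripheralInner a l m n) e
      pi a l m n (inner x) (u , v) = pos*pos (j<i⇒0<i-j u) (j<i⇒0<i-j v)
      pi a l m n (outer y) _ = ℤ.+<+ ℕ.z<s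
      go : ∀ γ e e' → Above γ e → Above γ e' → 0ℤ ℤ.< side γ e ℤ.* side γ e'
      go (bridging a b) e e' x y = pos*pos (br a b e x) (br a b e' y)
      go (peripheralOuter a l m n) e e' x y = pos*pos (po a l m n e x) (po a l m n e' y)
      go (peripheralInner a l m n) e e' x y = pos*pos (pi a l m n e x) (pi a l m n e' y)

    i≤+∣i∣ : ∀ i → i ℤ.≤ + ∣ i ∣
    i≤+∣i∣ (+ n)    = ℤₚ.≤-refl
    i≤+∣i∣ -[1+ n ] = ℤ.-≤+

    -i≤+∣i∣ : ∀ i → ℤ.- i ℤ.≤ + ∣ i ∣
    -i≤+∣i∣ i = subst (λ n → ℤ.- i ℤ.≤ + n) (ℤₚ.∣-i∣≡∣i∣ i) (i≤+∣i∣ (ℤ.- i))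

    far-right : ∀ c d m r .{{_ : NonZero r}} → ∣ c ∣ ℕ.+ ∣ d ∣ ℕ.< suc m →
                d ℤ.< c ℤ.+ + suc m ℤ.* + r
    far-right c d m r h = subst₂' (d-c<k)
      where
      open ℤₚ.≤-Reasoning
      d-c<k : d ℤ.- c ℤ.< + suc m ℤ.* + r
      d-c<k = begin-strict
        d ℤ.- c                    ≤⟨ ℤₚ.+-mono-≤ (i≤+∣i∣ d) (-i≤+∣i∣ c) ⟩
        + ∣ d ∣ ℤ.+ + ∣ c ∣        ≡⟨ cong +_ (ℕₚ.+-comm ∣ d ∣ ∣ c ∣) ⟩
        + (∣ c ∣ ℕ.+ ∣ d ∣)        <⟨ ℤ.+<+ h ⟩
        + suc m                    ≤⟨ ℤ.+≤+ (ℕₚ.m≤m*n (suc m) r) ⟩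
        + (suc m ℕ.* r)            ≡⟨ ℤₚ.pos-* (suc m) r ⟩
        + suc m ℤ.* + r            ∎
      eq : ∀ c d → c ℤ.+ (d ℤ.- c) ≡ d
      eq = solve-∀
      subst₂' : d ℤ.- c ℤ.< + suc m ℤ.* + r → d ℤ.< c ℤ.+ + suc m ℤ.* + r
      subst₂' u = subst (ℤ._< c ℤ.+ + suc m ℤ.* + r) (eq c d) (ℤₚ.+-monoʳ-< c u)

    far-left : ∀ c d m r .{{_ : NonZero r}} → ∣ c ∣ ℕ.+ ∣ d ∣ ℕ.< suc m →
               c ℤ.+ -[1+ m ] ℤ.* + r ℤ.< d
    far-left c d m r h = ℤₚ.neg-cancel-< (subst (ℤ.- d ℤ.<_) eq
        (far-right (ℤ.- c) (ℤ.- d) m r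
          (subst (ℕ._< suc m) (cong₂ ℕ._+_ (sym (ℤₚ.∣-i∣≡∣i∣ c)) (sym (ℤₚ.∣-i∣≡∣i∣ d))) h)))
      where
      eq' : ∀ c k r → ℤ.- c ℤ.+ k ℤ.* r ≡ ℤ.- (c ℤ.+ (ℤ.- k) ℤ.* r)
      eq' = solve-∀
      eq : ℤ.- c ℤ.+ + suc m ℤ.* + r ≡ ℤ.- (c ℤ.+ -[1+ m ] ℤ.* + r)
      eq = eq' c (+ suc m) (+ r)

    period : Point → ℕ
    period (outer _) = p
    period (inner _) = q

    period≢0 : ∀ e → NonZero (period e)
    period≢0 (outer _) = ℕ.>-nonZero (ℕ.>-nonZero⁻¹ p)
    period≢0 (inner _) = ℕ.>-nonZero (ℕ.>-nonZero⁻¹ q)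

    swap+ : ∀ a b c → a ℤ.+ b ℤ.+ c ≡ a ℤ.+ c ℤ.+ b
    swap+ = solve-∀

    deck-end₁ : ∀ k γ → coord (end₁ (deck k γ)) ≡ coord (end₁ γ) ℤ.+ k ℤ.* + period (end₁ γ)
    deck-end₁ k (bridging a b) = refl
    deck-end₁ k (peripheralOuter a l _ _) = refl
    deck-end₁ k (peripheralInner b l _ _) = refl

    deck-end₂ : ∀ k γ → coord (end₂ (deck k γ)) ≡ coord (end₂ γ) ℤ.+ k ℤ.* + period (end₂ γ)
    deck-end₂ k (bridging a b) = refl
    deck-end₂ k (peripheralOuter a l _ _) = swap+ a (k ℤ.* + p) (+ l)
    deck-end₂ k (peripheralInner b l _ _) = swap+ b (k ℤ.* + q) (+ l)

    add-< : ∀ {x y X Y n} → x ℕ.≤ X → y ℕ.≤ Y → X ℕ.+ Y ℕ.< n → y ℕ.+ x ℕ.< n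
    add-< {x} {y} {X} {Y} x≤X y≤Y X+Y<n =
      ℕₚ.≤-<-trans (subst (ℕ._≤ X ℕ.+ Y) (ℕₚ.+-comm x y) (ℕₚ.+-mono-≤ x≤X y≤Y)) X+Y<n

    end₁≤size : ∀ γ → ∣ coord (end₁ γ) ∣ ℕ.≤ size γ
    end₁≤size γ = ℕₚ.m≤m+n _ _

    end₂≤size : ∀ γ → ∣ coord (end₂ γ) ∣ ℕ.≤ size γ
    end₂≤size γ = ℕₚ.m≤n+m _ _

    far⇒¬crosses : ∀ γ γ' k → size γ ℕ.+ size γ' ℕ.< ∣ k ∣ → ¬ Crosses γ (deck k γ')
    far⇒¬crosses γ γ' k@(+ suc m) h cr = <0⇒¬>0 cr
        (sameSide-below γ _ _
          (below (end₁ γ') (deck-end₁ k γ') (end₁≤size γ'))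
          (below (end₂ γ') (deck-end₂ k γ') (end₂≤size γ')))
      where
      lt : ∀ e {y} → y ≡ coord e ℤ.+ k ℤ.* + period e → ∣ coord e ∣ ℕ.≤ size γ' →
           ∀ x → ∣ coord x ∣ ℕ.≤ size γ → coord x ℤ.< y
      lt e eq e≤ x x≤ = subst (coord x ℤ.<_) (sym eq)
        (far-right (coord e) (coord x) m (period e) {{period≢0 e}} (add-< x≤ e≤ h))
      below : ∀ e {y} → y ≡ coord e ℤ.+ k ℤ.* + period e → ∣ coord e ∣ ℕ.≤ size γ' →
              coord (end₁ γ) ℤ.< y × coord (end₂ γ) ℤ.< y
      below e eq e≤ = lt e eq e≤ (end₁ γ) (end₁≤size γ) , lt e eq e≤ (end₂ γ) (end₂≤size γ)
    far⇒¬crosses γ γ' k@(-[1+ m ]) h cr = <0⇒¬>0 cr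
        (sameSide-above γ _ _
          (above (end₁ γ') (deck-end₁ k γ') (end₁≤size γ'))
          (above (end₂ γ') (deck-end₂ k γ') (end₂≤size γ')))
      where
      lt : ∀ e {y} → y ≡ coord e ℤ.+ k ℤ.* + period e → ∣ coord e ∣ ℕ.≤ size γ' →
           ∀ x → ∣ coord x ∣ ℕ.≤ size γ → y ℤ.< coord x
      lt e eq e≤ x x≤ = subst (ℤ._< coord x) (sym eq)
        (far-left (coord e) (coord x) m (period e) {{period≢0 e}} (add-< x≤ e≤ h))
      above : ∀ e {y} → y ≡ coord e ℤ.+ k ℤ.* + period e → ∣ coord e ∣ ℕ.≤ size γ' →
              y ℤ.< coord (end₁ γ) × y ℤ.< coord (end₂ γ)
      above e eq e≤ = lt e eq e≤ (end₁ γ) (end₁≤size γ) , lt e eq e≤ (end₂ γ) (end₂≤size γ)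

    ∣k∣≤N⇒∈interval : ∀ N k → ∣ k ∣ ℕ.≤ N → k ∈ interval N
    ∣k∣≤N⇒∈interval N k h = subst (_∈ interval N) eq
        (∈-map⁺ (λ j → + j ℤ.- + N) (∈-upTo⁺ (ℕ.s≤s j≤N+N)))
      where
      0≤k+N : 0ℤ ℤ.≤ k ℤ.+ + N
      0≤k+N = subst (ℤ._≤ k ℤ.+ + N) (ℤₚ.+-inverseʳ k) (ℤₚ.+-monoʳ-≤ k
                (ℤₚ.≤-trans (-i≤+∣i∣ k) (ℤ.+≤+ h)))
      j≤N+N : ∣ k ℤ.+ + N ∣ ℕ.≤ N ℕ.+ N
      j≤N+N = ℕₚ.≤-trans (ℤₚ.∣i+j∣≤∣i∣+∣j∣ k (+ N)) (ℕₚ.+-monoˡ-≤ N h)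
      cancel : ∀ k n → k ℤ.+ n ℤ.- n ≡ k
      cancel = solve-∀
      eq : + ∣ k ℤ.+ + N ∣ ℤ.- + N ≡ k
      eq = trans (cong (ℤ._- + N) (ℤₚ.0≤i⇒+∣i∣≡i 0≤k+N)) (cancel k (+ N))

  crossings-in-interval : ∀ γ γ' k → Crosses γ (deck k γ') → k ∈ interval (size γ ℕ.+ size γ')
  crossings-in-interval γ γ' k cr with ∣ k ∣ ℕₚ.≤? size γ ℕ.+ size γ'
  ... | yes h = ∣k∣≤N⇒∈interval _ k h
  ... | no ¬h = contradiction cr (far⇒¬crosses γ γ' k (ℕₚ.≰⇒> ¬h))

  instance
    p+q≢0 : NonZero (p ℕ.+ q)
    p+q≢0 = ℕ.>-nonZero (ℕₚ.<-≤-trans (ℕ.>-nonZero⁻¹ p) (ℕₚ.m≤m+n p q))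

  -- The arc with index j < p is (j , 0), the arc with index p + j, j < q, is
  -- (p , j); indices are read modulo p + q, as (p , q) = (0 , 0) in the annulus.
  vertex : ℕ → Fin (p ℕ.+ q)
  vertex m = m mod (p ℕ.+ q)

  τ : Fin (p ℕ.+ q) → Arc
  τ i = [ (λ j → bridging (+ toℕ j) 0ℤ) , (λ j → bridging (+ p) (+ toℕ j)) ]′ (splitAt p i)

  s t : Fin (p ℕ.+ q)
  s = vertex 0
  t = vertex p

  InT : Arc → Set
  InT γ = ∃ λ i → γ ≈ τ i

  -- One arrow for each triangle, between its two sides in T: the outer triangle
  -- with sides (j , 0), (j + 1 , 0) and the inner one with sides (p , j + 1),
  -- (p , j), in this (rotational) order.
  Q : Quiver
  Q = record
    { V   = p ℕ.+ q
    ; E   = p ℕ.+ q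
    ; src = λ α → [ (λ j → vertex (toℕ j)) , (λ j → vertex (p ℕ.+ suc (toℕ j))) ]′ (splitAt p α)
    ; tgt = λ α → [ (λ j → vertex (suc (toℕ j))) , (λ j → vertex (p ℕ.+ toℕ j)) ]′ (splitAt p α)
    }

  τ-< : ∀ {m} → (h : m ℕ.< p) → τ (vertex m) ≡ bridging (+ m) 0ℤ
  τ-< {m} h = trans (cong [ _ , _ ]′ (Finₚ.splitAt-< p (vertex m) h')) (cong (λ j → bridging (+ j) 0ℤ)
      (trans (Finₚ.toℕ-fromℕ< h') toℕ-vertex))
    where
    toℕ-vertex : toℕ (vertex m) ≡ m
    toℕ-vertex = trans (Finₚ.toℕ-fromℕ< _) (DivMod.m<n⇒m%n≡m (ℕₚ.<-≤-trans h (ℕₚ.m≤m+n p q)))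
    h' : toℕ (vertex m) ℕ.< p
    h' = subst (ℕ._< p) (sym toℕ-vertex) h

  τ-≥ : ∀ {m} → m ℕ.< q → τ (vertex (p ℕ.+ m)) ≡ bridging (+ p) (+ m)
  τ-≥ {m} h = trans (cong [ _ , _ ]′ (Finₚ.splitAt-≥ p (vertex (p ℕ.+ m)) h'))
      (cong (λ j → bridging (+ p) (+ j)) (trans (toℕ-reduce (vertex (p ℕ.+ m)) h')
        (trans (cong (ℕ._∸ p) toℕ-vertex) (ℕₚ.m+n∸m≡n p m))))
    where
    toℕ-reduce : ∀ {m n} (i : Fin (m ℕ.+ n)) .(h : m ℕ.≤ toℕ i) → toℕ (Fin.reduce≥ i h) ≡ toℕ i ℕ.∸ m
    toℕ-reduce {zero}  i           h = refl
    toℕ-reduce {suc m} (Fin.suc i) h = toℕ-reduce {m} i _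
    toℕ-vertex : toℕ (vertex (p ℕ.+ m)) ≡ p ℕ.+ m
    toℕ-vertex = trans (Finₚ.toℕ-fromℕ< _) (DivMod.m<n⇒m%n≡m (ℕₚ.+-monoʳ-< p h))
    h' : p ℕ.≤ toℕ (vertex (p ℕ.+ m))
    h' = subst (p ℕ.≤_) (sym toℕ-vertex) (ℕₚ.m≤m+n p m)

  ≡⇒≈ : ∀ {a b γ} → γ ≡ bridging a b → γ ≈ bridging a b
  ≡⇒≈ {a} {b} refl = 0ℤ , cong₂ bridging (ℤₚ.+-identityʳ a) (ℤₚ.+-identityʳ b)

  -- T consists of the arcs (j , 0), 0 ≤ j ≤ p, and (p , j), 0 ≤ j ≤ q.
  τ-outerFan : ∀ {j} → j ℕ.≤ p → τ (vertex j) ≈ bridging (+ j) 0ℤ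
  τ-outerFan {j} j≤p with ℕₚ.m≤n⇒m<n∨m≡n j≤p
  ... | inj₁ j<p  = ≡⇒≈ (τ-< j<p)
  ... | inj₂ refl = ≡⇒≈ (trans (cong (τ ∘ vertex) (sym (ℕₚ.+-identityʳ p))) (τ-≥ (ℕ.>-nonZero⁻¹ q)))

  τ-innerFan : ∀ {j} → j ℕ.≤ q → τ (vertex (p ℕ.+ j)) ≈ bridging (+ p) (+ j)
  τ-innerFan {j} j≤q with ℕₚ.m≤n⇒m<n∨m≡n j≤q
  ... | inj₁ j<q  = ≡⇒≈ (τ-≥ j<q)
  ... | inj₂ refl = 1ℤ , trans (cong (deck 1ℤ) (trans (cong τ vertex-p+q) (τ-< (ℕ.>-nonZero⁻¹ p))))
        (cong₂ bridging (one (+ p)) (one (+ q)))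
    where
    vertex-p+q : vertex (p ℕ.+ q) ≡ vertex 0
    vertex-p+q = Finₚ.toℕ-injective (trans (Finₚ.toℕ-fromℕ< _)
      (trans (DivMod.n%n≡0 (p ℕ.+ q)) (sym (trans (Finₚ.toℕ-fromℕ< _) (DivMod.m<n⇒m%n≡m (ℕ.>-nonZero⁻¹ (p ℕ.+ q)))))))
    one : ∀ x → 0ℤ ℤ.+ 1ℤ ℤ.* x ≡ x
    one = solve-∀

  crossings : Arc → Fin (p ℕ.+ q) → ℤ
  crossings γ i = + i⟨ γ , τ i ⟩

  δ : Fin (p ℕ.+ q) → ℤ
  δ _ = 1ℤ

  ∂ : (Fin (p ℕ.+ q) → ℤ) → ℤ
  ∂ x = euler Q δ x

  π : (Fin (p ℕ.+ q) → ℤ) → ℤ × ℤ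
  π x = x s , x t

-- The line u - v = d of the (u , v)-plane.
OnLine : ℤ → ℤ × ℤ → Set
OnLine d (u , v) = u ℤ.- v ≡ d

-- Slope -1 before m, constant between m and m', slope 1 from m' on.
VShaped : (ℤ → ℤ) → Set
VShaped f = ∃ λ m → ∃ λ m' → m ℤ.≤ m' ×
  (∀ k → k ℤ.< m → f (k ℤ.+ 1ℤ) ≡ f k ℤ.- 1ℤ) ×
  (∀ k → m ℤ.≤ k → k ℤ.< m' → f (k ℤ.+ 1ℤ) ≡ f k) ×
  (∀ k → m' ℤ.≤ k → f (k ℤ.+ 1ℤ) ≡ f k ℤ.+ 1ℤ)

module AnnulusModules {c ℓ₁ ℓ₂ : Level} (K : HeytingField c ℓ₁ ℓ₂)
                      (p q : ℕ) .{{_ : NonZero p}} .{{_ : NonZero q}} where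
  open Annulus p q public
  open Representations K Q public

  Preprojective Regular Preinjective Transjective : Rep → Set (c ⊔ ℓ₁)
  Preprojective M = Indecomposable M × ∂ (dimVec M) ℤ.< 0ℤ
  Regular       M = Indecomposable M × ∂ (dimVec M) ≡ 0ℤ
  Preinjective  M = Indecomposable M × 0ℤ ℤ.< ∂ (dimVec M)
  Transjective  M = Preprojective M ⊎ Preinjective M

  -- The bijection γ ↦ M_γ between essential arcs not in T and (isomorphism
  -- classes of) exceptional modules.
  record Dictionary : Set (c ⊔ ℓ₁) where
    field
      M[_] : ∀ {γ} → ¬ InT γ → Rep
      dimension : ∀ {γ} (γ∉T : ¬ InT γ) → dimVec M[ γ∉T ] ≗ crossings γ
      exceptional : ∀ {γ} (γ∉T : ¬ InT γ) → Exceptional M[ γ∉T ]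
      well-defined : ∀ {γ γ'} (γ∉T : ¬ InT γ) (γ'∉T : ¬ InT γ') →
                     γ ≈ γ' → M[ γ∉T ] ≅ M[ γ'∉T ]
      injective : ∀ {γ γ'} (γ∉T : ¬ InT γ) (γ'∉T : ¬ InT γ') →
                  M[ γ∉T ] ≅ M[ γ'∉T ] → γ ≈ γ'
      surjective : ∀ N → Exceptional N → ∃ λ γ → Σ (¬ InT γ) λ γ∉T → M[ γ∉T ] ≅ N

    -- The line c_s - c_t = d carries the arc γ.
    Carries : ℤ → ∀ {γ} → ¬ InT γ → Set
    Carries d γ∉T = OnLine d (π (dimVec M[ γ∉T ]))

  -- C(Q) = { ± β : β the dimension vector of an exceptional module }.
  CVectorsOfQ : Set (c ⊔ ℓ₁)
  CVectorsOfQ = ∀ x → IsCVector Q x ⇔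
    (∃ λ N → Exceptional N × (x ≗ dimVec N ⊎ x ≗ (λ i → ℤ.- dimVec N i)))

{-# OPTIONS --safe #-}
module Submission where

open import Defs
open import Data.Nat as ℕ using (ℕ; suc; NonZero)
import Data.Nat.DivMod as DivMod
import Data.Nat.Properties as ℕₚ
open import Data.Integer as ℤ
  using (ℤ; +_; -[1+_]; 0ℤ; 1ℤ; -1ℤ; ∣_∣; _+_; _-_; -_; _*_; _≤_; _<_; _⊔_)
open import Data.Integer.DivMod
  using (_/ℕ_; _%ℕ_; [n/ℕd]*d≤n; n<s[n/ℕd]*d; a≡a%ℕn+[a/ℕn]*n; n%ℕd<d)
import Data.Integer.Properties as ℤₚ
open import Data.Integer.Tactic.RingSolver using (solve; solve-∀)
open import Data.Fin as Fin using (Fin; toℕ; splitAt; _↑ˡ_; _↑ʳ_)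
import Data.Fin.Properties as Finₚ
open import Data.Empty using (⊥)
open import Data.Unit using (tt)
open import Data.Product using (Σ; ∃; _×_; _,_; proj₁; proj₂; swap)
open import Data.Sum using (_⊎_; inj₁; inj₂; [_,_]′)
open import Data.List
  using (List; []; _∷_; [_]; _++_; map; filter; length; concatMap; upTo; applyUpTo)
import Data.List.Properties as Listₚ
open import Data.List.Membership.Propositional using (_∈_; lose)
open import Data.List.Membership.Propositional.Properties
  using (∈-map⁻; ∈-upTo⁺; ∈-upTo⁻; ∈-concatMap⁺; ∈-++⁺ˡ; ∈-++⁺ʳ)
import Data.List.Relation.Unary.All as All
import Data.List.Relation.Unary.All.Properties as Allₚ
open import Data.List.Relation.Unary.Any using (Any; here)
open import Function using (_∘_; _⇔_; mk⇔; Equivalence)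
open import Relation.Nullary using (¬_; yes; no; contradiction)
open import Relation.Unary using (Pred; Decidable)
open import Relation.Binary.PropositionalEquality
  using (_≡_; _≢_; _≗_; refl; sym; trans; cong; cong₂; subst; module ≡-Reasoning)
open import Algebra.Apartness.Bundles using (HeytingField)
import Algebra.Properties.Monoid.Sum ℤₚ.+-0-monoid as Sum

-- For x, y ∈ ℤ the number of k with (x - k m)(y - k n) < 0 counts the integers
-- strictly between x / m and y / n, so it is A⁺ + B⁺ with A = ⌈x/m⌉ - ⌊y/n⌋ - 1
-- and B = ⌈y/n⌉ - ⌊x/m⌋ - 1, where A + B ≤ 0.  For the crossings of a bridging
-- arc with an arc of T, twisting replaces (A , B) by (A + 1 , B - 1), whence the
-- V shape.  At s the pair (A , B) decides everything: the arc lies in T iff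
-- A ≤ 0 and B < 0, and otherwise exactly one of 1 ≤ A (defect 1) and 0 ≤ B
-- (defect -1) holds, because passing from s to t replaces (A , B) by
-- (A - 1 , B + 1).  A peripheral arc crosses the arcs s and t equally often,
-- since they have the same end points in the annulus.

-- Linear arithmetic: hypotheses i ≤ j and i < j enter as the nonnegative
-- numbers j - i and j - (1 + i), which are added up and compared with the goal.

-- The defect sees only the coordinates `s` and `t`, while the shift by `δ` concerns all coordinates
-- at once, and each arc of T has its own pair (A , B). The shift nevertheless sets in everywhere as
-- soon as the defect is ±1: every arc of T lies between s and t, or between t and the deck
-- translate (p , q) of s, and by monotonicity its A is at least that of s minus 1 and its B at
-- least that of s. The defect ±1 itself comes from t = (p , 0) being the Dehn twist of s = (0 , 0):
-- the crossing numbers with s and t are neighbouring values of one V. The inequalities that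
-- characterize T say that neither s nor t is crossed; these two arcs cut the annulus into two
-- polygons, whose bridging arcs are exactly the two fans. The right arm of an orbit starts at the
-- point (1 , 0) of the plane and the left arm at (0 , 1), so dimension vectors alone fill only half
-- of each off-diagonal line. The other half consists of negatives of dimension vectors from the
-- opposite arm.

infixl 6 _⊞_
infix  5 _∴≤_ _∴<_ _∴⊥_

gap : ∀ {i j} → i ≤ j → 0ℤ ≤ j - i
gap = ℤₚ.i≤j⇒0≤j-i

gap< : ∀ {i j} → i < j → 0ℤ ≤ j - (1ℤ + i)
gap< i<j = gap (ℤₚ.i<j⇒suc[i]≤j i<j)

_⊞_ : ∀ {i j} → 0ℤ ≤ i → 0ℤ ≤ j → 0ℤ ≤ i + j
_⊞_ = ℤₚ.+-mono-≤

_∴≤_ : ∀ {i j e} → 0ℤ ≤ e → e ≡ j - i → i ≤ j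
0≤e ∴≤ eq = ℤₚ.0≤i-j⇒j≤i (subst (0ℤ ≤_) eq 0≤e)

_∴<_ : ∀ {i j e} → 0ℤ ≤ e → e ≡ j - (1ℤ + i) → i < j
0≤e ∴< eq = ℤₚ.suc[i]≤j⇒i<j (0≤e ∴≤ eq)

_∴⊥_ : ∀ {e} → 0ℤ ≤ e → e ≡ -1ℤ → ⊥
0≤e ∴⊥ refl with () ← 0≤e

<⊎≥ : ∀ i j → i < j ⊎ j ≤ i
<⊎≥ i j with i ℤₚ.<? j
... | yes i<j = inj₁ i<j
... | no  i≮j = inj₂ (ℤₚ.≮⇒≥ i≮j)

-- Floors and ceilings of fractions

⌊_/_⌋ ⌈_/_⌉ : ℤ → (n : ℕ) .{{_ : NonZero n}} → ℤ
⌊ x / n ⌋ = x /ℕ n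
⌈ x / n ⌉ = - ⌊ - x / n ⌋

module _ {n : ℕ} .{{_ : NonZero n}} where

  -- This and the next seven lemmas are the Galois connections of floor and ceiling with
  -- multiplication by `n`. The ceiling versions arise by negation, the non-strict ones by
  -- contraposition.
  <*⇒⌊⌋< : ∀ x k → x < k * + n → ⌊ x / n ⌋ < k
  <*⇒⌊⌋< x k h = ℤₚ.*-cancelʳ-<-nonNeg (+ n) (ℤₚ.≤-<-trans ([n/ℕd]*d≤n x n) h)

  ⌊⌋<⇒<* : ∀ x k → ⌊ x / n ⌋ < k → x < k * + n
  ⌊⌋<⇒<* x k h =
    ℤₚ.<-≤-trans (n<s[n/ℕd]*d x n) (ℤₚ.*-monoʳ-≤-nonNeg (+ n) (ℤₚ.i<j⇒suc[i]≤j h))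

  *<⇒<⌈⌉ : ∀ x k → k * + n < x → k < ⌈ x / n ⌉
  *<⇒<⌈⌉ x k h = subst (_< ⌈ x / n ⌉) (ℤₚ.neg-involutive k)
    (ℤₚ.neg-mono-< (<*⇒⌊⌋< (- x) (- k)
      (subst (- x <_) (ℤₚ.neg-distribˡ-* k (+ n)) (ℤₚ.neg-mono-< h))))

  <⌈⌉⇒*< : ∀ x k → k < ⌈ x / n ⌉ → k * + n < x
  <⌈⌉⇒*< x k h = ℤₚ.neg-cancel-< (subst (- x <_) (sym (ℤₚ.neg-distribˡ-* k (+ n)))
    (⌊⌋<⇒<* (- x) (- k) (subst (_< - k) (ℤₚ.neg-involutive ⌊ - x / n ⌋) (ℤₚ.neg-mono-< h))))

  *≤⇒≤⌊⌋ : ∀ x k → k * + n ≤ x → k ≤ ⌊ x / n ⌋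
  *≤⇒≤⌊⌋ x k h = ℤₚ.≮⇒≥ λ f<k → ℤₚ.<⇒≱ (⌊⌋<⇒<* x k f<k) h

  ≤⌊⌋⇒*≤ : ∀ x k → k ≤ ⌊ x / n ⌋ → k * + n ≤ x
  ≤⌊⌋⇒*≤ x k h = ℤₚ.≮⇒≥ λ x<kn → ℤₚ.<⇒≱ (<*⇒⌊⌋< x k x<kn) h

  ≤*⇒⌈⌉≤ : ∀ x k → x ≤ k * + n → ⌈ x / n ⌉ ≤ k
  ≤*⇒⌈⌉≤ x k h = ℤₚ.≮⇒≥ λ k<c → ℤₚ.<⇒≱ (<⌈⌉⇒*< x k k<c) h

  ⌈⌉≤⇒≤* : ∀ x k → ⌈ x / n ⌉ ≤ k → x ≤ k * + n
  ⌈⌉≤⇒≤* x k h = ℤₚ.≮⇒≥ λ kn<x → ℤₚ.<⇒≱ (*<⇒<⌈⌉ x k kn<x) h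

  ⌊⌋≤⌈⌉ : ∀ x → ⌊ x / n ⌋ ≤ ⌈ x / n ⌉
  ⌊⌋≤⌈⌉ x = ℤₚ.≮⇒≥ λ c<f → ℤₚ.<⇒≱
    (ℤₚ.*-monoʳ-<-pos (+ n) {{ℤ.positive (ℤ.+<+ (ℕ.>-nonZero⁻¹ n))}} c<f)
    (ℤₚ.≤-trans ([n/ℕd]*d≤n x n) (⌈⌉≤⇒≤* x ⌈ x / n ⌉ ℤₚ.≤-refl))

  ⌈⌉≤1+⌊⌋ : ∀ x → ⌈ x / n ⌉ ≤ 1ℤ + ⌊ x / n ⌋
  ⌈⌉≤1+⌊⌋ x = ≤*⇒⌈⌉≤ x _ (ℤₚ.<⇒≤ (n<s[n/ℕd]*d x n))

  ⌊⌋-mono : ∀ x y → x ≤ y → ⌊ x / n ⌋ ≤ ⌊ y / n ⌋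
  ⌊⌋-mono x y x≤y = *≤⇒≤⌊⌋ y _ (ℤₚ.≤-trans ([n/ℕd]*d≤n x n) x≤y)

  ⌈⌉-mono : ∀ x y → x ≤ y → ⌈ x / n ⌉ ≤ ⌈ y / n ⌉
  ⌈⌉-mono x y x≤y = ℤₚ.neg-mono-≤ (⌊⌋-mono (- y) (- x) (ℤₚ.neg-mono-≤ x≤y))

  ⌊⌋-shift : ∀ x k → ⌊ x + k * + n / n ⌋ ≡ ⌊ x / n ⌋ + k
  ⌊⌋-shift x k = ℤₚ.≤-antisym
      (unshift _ (*≤⇒≤⌊⌋ x _ (down ⌊ x + k * + n / n ⌋ (+ n) ([n/ℕd]*d≤n (x + k * + n) n))))
      (*≤⇒≤⌊⌋ (x + k * + n) _ (up ⌊ x / n ⌋ (+ n) ([n/ℕd]*d≤n x n)))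
    where
    unshift : ∀ f {g} → f - k ≤ g → f ≤ g + k
    unshift f {g} h = gap h ∴≤ solve (f ∷ g ∷ k ∷ [])
    down : ∀ f m → f * m ≤ x + k * m → (f - k) * m ≤ x
    down f m h = gap h ∴≤ solve (f ∷ m ∷ k ∷ x ∷ [])
    up : ∀ f m → f * m ≤ x → (f + k) * m ≤ x + k * m
    up f m h = gap h ∴≤ solve (f ∷ m ∷ k ∷ x ∷ [])

  ⌈⌉-shift : ∀ x k → ⌈ x + k * + n / n ⌉ ≡ ⌈ x / n ⌉ + k
  ⌈⌉-shift x k = begin
    - ⌊ - (x + k * + n) / n ⌋     ≡⟨ cong (λ y → - ⌊ y / n ⌋) (neg-shift (+ n)) ⟩
    - ⌊ - x + (- k) * + n / n ⌋   ≡⟨ cong -_ (⌊⌋-shift (- x) (- k)) ⟩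
    - (⌊ - x / n ⌋ - k)           ≡⟨ neg-sub ⌊ - x / n ⌋ ⟩
    - ⌊ - x / n ⌋ + k             ∎
    where
    open ≡-Reasoning
    neg-shift : ∀ m → - (x + k * m) ≡ - x + (- k) * m
    neg-shift m = solve (x ∷ k ∷ m ∷ [])
    neg-sub : ∀ f → - (f - k) ≡ - f + k
    neg-sub f = solve (f ∷ k ∷ [])

-- If positive, the number of k ∈ ℤ with y / n < k < x / m.
excess : ℤ → (m : ℕ) .{{_ : NonZero m}} → ℤ → (n : ℕ) .{{_ : NonZero n}} → ℤ
excess x m y n = ⌈ x / m ⌉ - ⌊ y / n ⌋ - 1ℤ

module _ {m n : ℕ} .{{_ : NonZero m}} .{{_ : NonZero n}} where

  -- Only `k - j` survives: a deck transformation (`k ≡ j`) changes nothing, and a power of the Dehn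
  -- twist, which moves one of the two fractions, acts by a translation.
  excess-shift : ∀ x y k j → excess (x + k * + m) m (y + j * + n) n ≡ excess x m y n + (k - j)
  excess-shift x y k j =
      trans (cong₂ (λ c f → c - f - 1ℤ) (⌈⌉-shift x k) (⌊⌋-shift y j))
        (regroup ⌈ x / m ⌉ ⌊ y / n ⌋)
    where
    regroup : ∀ c f → c + k - (f + j) - 1ℤ ≡ c - f - 1ℤ + (k - j)
    regroup c f = solve (c ∷ f ∷ k ∷ j ∷ [])

  excess-mono : ∀ x x' y y' → x ≤ x' → y' ≤ y → excess x m y n ≤ excess x' m y' n
  excess-mono x x' y y' x≤x' y'≤y =
    ℤₚ.+-monoˡ-≤ -1ℤ (ℤₚ.+-mono-≤ (⌈⌉-mono x x' x≤x') (ℤₚ.neg-mono-≤ (⌊⌋-mono y' y y'≤y)))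

  excess-≤ : ∀ x y c f → x ≤ c * + m → f * + n ≤ y → excess x m y n ≤ c - f - 1ℤ
  excess-≤ x y c f x≤cm fn≤y = ℤₚ.+-monoˡ-≤ -1ℤ
    (ℤₚ.+-mono-≤ (≤*⇒⌈⌉≤ x c x≤cm) (ℤₚ.neg-mono-≤ (*≤⇒≤⌊⌋ y f fn≤y)))

  -- Regroup by fraction: a ceiling exceeds the floor of the same fraction by at most one, and the
  -- two summands -1 absorb this.
  excess-sum≤0 : ∀ x y → excess x m y n + excess y n x m ≤ 0ℤ
  excess-sum≤0 x y = lemma (⌈⌉≤1+⌊⌋ x) (⌈⌉≤1+⌊⌋ y)
    where
    lemma : ∀ {cx fx cy fy} → cx ≤ 1ℤ + fx → cy ≤ 1ℤ + fy →
            (cx - fy - 1ℤ) + (cy - fx - 1ℤ) ≤ 0ℤ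
    lemma {cx} {fx} {cy} {fy} h h' = gap h ⊞ gap h' ∴≤ solve (cx ∷ fx ∷ cy ∷ fy ∷ [])

-- Wherever `A + B ≤ 0`, at most one summand is positive and the value is the maximum of `A`, `B`
-- and 0.
valley : ℤ → ℤ → ℤ
valley A B = (A ⊔ 0ℤ) + (B ⊔ 0ℤ)

module _ (A B : ℤ) where

  valley-right : A + B ≤ 0ℤ → 0ℤ ≤ A → valley A B ≡ A
  valley-right A+B≤0 0≤A = trans
    (cong₂ _+_ (ℤₚ.i≥j⇒i⊔j≡i 0≤A) (ℤₚ.i≤j⇒i⊔j≡j B≤0)) (ℤₚ.+-identityʳ A)
    where
    B≤0 : B ≤ 0ℤ
    B≤0 = gap A+B≤0 ⊞ gap 0≤A ∴≤ solve (A ∷ B ∷ [])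

  valley-left : A + B ≤ 0ℤ → 0ℤ ≤ B → valley A B ≡ B
  valley-left A+B≤0 0≤B = trans
    (cong₂ _+_ (ℤₚ.i≤j⇒i⊔j≡j A≤0) (ℤₚ.i≥j⇒i⊔j≡i 0≤B)) (ℤₚ.+-identityˡ B)
    where
    A≤0 : A ≤ 0ℤ
    A≤0 = gap A+B≤0 ⊞ gap 0≤B ∴≤ solve (A ∷ B ∷ [])

  valley-bottom : A ≤ 0ℤ → B ≤ 0ℤ → valley A B ≡ 0ℤ
  valley-bottom A≤0 B≤0 = cong₂ _+_ (ℤₚ.i≤j⇒i⊔j≡j A≤0) (ℤₚ.i≤j⇒i⊔j≡j B≤0)

-- Counting integers between two fractions

applyUpTo-++ : ∀ {a} {X : Set a} (g : ℕ → X) m n →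
  applyUpTo g (m ℕ.+ n) ≡ applyUpTo g m ++ applyUpTo (g ∘ (m ℕ.+_)) n
applyUpTo-++ g ℕ.zero  n = refl
applyUpTo-++ g (suc m) n = cong (g 0 ∷_) (applyUpTo-++ (g ∘ suc) m n)

module _ {a p} {X : Set a} {P : Pred X p} (P? : Decidable P) where

  count-window : ∀ (g : ℕ → X) m w r →
    (∀ {i} → i ℕ.< m → ¬ P (g i)) →
    (∀ {i} → i ℕ.< w → P (g (m ℕ.+ i))) →
    (∀ {i} → i ℕ.< r → ¬ P (g (m ℕ.+ (w ℕ.+ i)))) →
    length (filter P? (applyUpTo g (m ℕ.+ (w ℕ.+ r)))) ≡ w
  count-window g m w r below inside above = begin
    length (filter P? (applyUpTo g (m ℕ.+ (w ℕ.+ r))))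
      ≡⟨ cong (length ∘ filter P?) (applyUpTo-++ g m (w ℕ.+ r)) ⟩
    length (filter P? (applyUpTo g m ++ applyUpTo g₁ (w ℕ.+ r)))
      ≡⟨ cong length (Listₚ.filter-++ P? (applyUpTo g m) _) ⟩
    length (filter P? (applyUpTo g m) ++ filter P? (applyUpTo g₁ (w ℕ.+ r)))
      ≡⟨ cong (λ xs → length (xs ++ filter P? (applyUpTo g₁ (w ℕ.+ r))))
           (Listₚ.filter-none P? (Allₚ.applyUpTo⁺₁ g m below)) ⟩
    length (filter P? (applyUpTo g₁ (w ℕ.+ r)))
      ≡⟨ cong (length ∘ filter P?) (applyUpTo-++ g₁ w r) ⟩
    length (filter P? (applyUpTo g₁ w ++ applyUpTo g₂ r))
      ≡⟨ cong length (Listₚ.filter-++ P? (applyUpTo g₁ w) _) ⟩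
    length (filter P? (applyUpTo g₁ w) ++ filter P? (applyUpTo g₂ r))
      ≡⟨ cong₂ (λ xs ys → length (xs ++ ys))
           (Listₚ.filter-all P? (Allₚ.applyUpTo⁺₁ g₁ w inside))
           (Listₚ.filter-none P? (Allₚ.applyUpTo⁺₁ g₂ r above)) ⟩
    length (applyUpTo g₁ w ++ [])
      ≡⟨ cong length (Listₚ.++-identityʳ (applyUpTo g₁ w)) ⟩
    length (applyUpTo g₁ w)
      ≡⟨ Listₚ.length-applyUpTo g₁ w ⟩
    w ∎
    where
    open ≡-Reasoning
    g₁ g₂ : ℕ → X
    g₁ i = g (m ℕ.+ i)
    g₂ i = g (m ℕ.+ (w ℕ.+ i))

-- Definitionally the list `interval` that underlies the crossing numbers, restated without the
-- parameters `p` and `q`.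
within : ℕ → List ℤ
within N = map (λ j → + j - + N) (upTo (suc (N ℕ.+ N)))

∈-within⁻ : ∀ N {k} → k ∈ within N → ∃ λ j → j ℕ.≤ N ℕ.+ N × k ≡ + j - + N
∈-within⁻ N k∈ = let j , j∈ , eq = ∈-map⁻ (λ j → + j - + N) k∈ in j , ℕ.s≤s⁻¹ (∈-upTo⁻ j∈) , eq

module _ {ℓ} {P : Pred ℤ ℓ} (P? : Decidable P) (N : ℕ) where

  -- `j` and `j + w` are the positions of the first and the last solution in the list, whence
  -- `suc w` solutions; `r` entries follow the last one.
  count-in-window : ∀ {lo hi} j w r → (∀ {k} → P k ⇔ (lo < k × k < hi)) →
    lo + 1ℤ ≡ + j - + N → hi - 1ℤ ≡ + (j ℕ.+ w) - + N → j ℕ.+ w ℕ.+ r ≡ N ℕ.+ N →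
    length (filter P? (within N)) ≡ suc w
  count-in-window {lo} {hi} j w r P⇔ first last total = begin
      length (filter P? (map g (upTo (suc (N ℕ.+ N)))))
        ≡⟨ cong (length ∘ filter P?) (Listₚ.map-upTo g (suc (N ℕ.+ N))) ⟩
      length (filter P? (applyUpTo g (suc (N ℕ.+ N))))
        ≡⟨ cong (length ∘ filter P? ∘ applyUpTo g) length≡ ⟩
      length (filter P? (applyUpTo g (j ℕ.+ (suc w ℕ.+ r))))
        ≡⟨ count-window P? g j (suc w) r
             (λ i<j Pk → before (+ N) first (ℤ.+<+ i<j) (proj₁ (to P⇔ Pk)))
             (λ {i} i≤w → from P⇔
               ( after (+ N) first (ℤ.+≤+ (ℕₚ.m≤m+n j i))
               , until (+ N) last (ℤ.+≤+ (ℕₚ.+-monoʳ-≤ j (ℕ.s≤s⁻¹ i≤w)))))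
             (λ {i} _ Pk → beyond (+ N) last
               (ℤ.+<+ (ℕₚ.+-monoʳ-< j (ℕ.s≤s (ℕₚ.m≤m+n w i)))) (proj₂ (to P⇔ Pk))) ⟩
      suc w ∎
    where
    open ≡-Reasoning
    open Equivalence using (to; from)
    g : ℕ → ℤ
    g i = + i - + N
    length≡ : suc (N ℕ.+ N) ≡ j ℕ.+ (suc w ℕ.+ r)
    length≡ = trans (cong suc (trans (sym total) (ℕₚ.+-assoc j w r)))
      (sym (ℕₚ.+-suc j (w ℕ.+ r)))
    before : ∀ {x y} z → lo + 1ℤ ≡ y - z → x < y → ¬ lo < x - z
    before {x} {y} z e h h' = gap (ℤₚ.≤-reflexive (sym e)) ⊞ gap< h ⊞ gap< h'
      ∴⊥ solve (lo ∷ x ∷ y ∷ z ∷ [])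
    after : ∀ {x y} z → lo + 1ℤ ≡ x - z → x ≤ y → lo < y - z
    after {x} {y} z e h = gap (ℤₚ.≤-reflexive e) ⊞ gap h ∴< solve (lo ∷ x ∷ y ∷ z ∷ [])
    until : ∀ {x y} z → hi - 1ℤ ≡ y - z → x ≤ y → x - z < hi
    until {x} {y} z e h = gap (ℤₚ.≤-reflexive (sym e)) ⊞ gap h ∴< solve (hi ∷ x ∷ y ∷ z ∷ [])
    beyond : ∀ {x y} z → hi - 1ℤ ≡ x - z → x < y → ¬ y - z < hi
    beyond {x} {y} z e h h' = gap (ℤₚ.≤-reflexive e) ⊞ gap< h ⊞ gap< h'
      ∴⊥ solve (hi ∷ x ∷ y ∷ z ∷ [])

  count-between : ∀ lo hi → (∀ {k} → P k ⇔ (lo < k × k < hi)) → (∀ {k} → P k → k ∈ within N) →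
    + length (filter P? (within N)) ≡ (hi - lo - 1ℤ) ⊔ 0ℤ
  count-between lo hi P⇔ P⇒∈ with <⊎≥ 0ℤ (hi - lo - 1ℤ)
  ... | inj₂ w≤0 = trans
      (cong (+_ ∘ length) (Listₚ.filter-none P? (All.universal (λ _ → empty) (within N))))
      (sym (ℤₚ.i≤j⇒i⊔j≡j w≤0))
    where
    empty : ∀ {k} → ¬ P k
    empty {k} Pk with lo<k , k<hi ← Equivalence.to P⇔ Pk =
      gap w≤0 ⊞ gap< lo<k ⊞ gap< k<hi ∴⊥ solve (lo ∷ hi ∷ k ∷ [])
  -- The extreme candidates `lo + 1` and `hi - 1` are solutions because the width is positive. Hence
  -- both occur in the list, and their positions delimit the window.
  ... | inj₁ 0<w = window
      (∈-within⁻ N (P⇒∈ (Equivalence.from (P⇔ {lo + 1ℤ})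
        (gap (ℤₚ.≤-refl {0ℤ}) ∴< solve (lo ∷ []) , gap< 0<w ∴< solve (lo ∷ hi ∷ [])))))
      (∈-within⁻ N (P⇒∈ (Equivalence.from (P⇔ {hi - 1ℤ})
        (gap< 0<w ∴< solve (lo ∷ hi ∷ []) , gap (ℤₚ.≤-refl {0ℤ}) ∴< solve (hi ∷ [])))))
    where
    ordered : ∀ {x y z} → lo + 1ℤ ≡ x - z → hi - 1ℤ ≡ y - z → x ≤ y
    ordered {x} {y} {z} e e' =
      gap (ℤₚ.≤-reflexive (sym e)) ⊞ gap (ℤₚ.≤-reflexive e') ⊞ gap< 0<w
        ∴≤ solve (lo ∷ hi ∷ x ∷ y ∷ z ∷ [])
    width : ∀ {x} y {z} → lo + 1ℤ ≡ x - z → hi - 1ℤ ≡ x + y - z → 1ℤ + y ≡ hi - lo - 1ℤ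
    width {x} y {z} e e' = begin
      1ℤ + y                              ≡⟨ solve (x ∷ y ∷ z ∷ []) ⟩
      (x + y - z) - (x - z) + 1ℤ          ≡⟨ cong₂ (λ u v → u - v + 1ℤ) e' e ⟨
      hi - 1ℤ - (lo + 1ℤ) + 1ℤ            ≡⟨ solve (lo ∷ hi ∷ []) ⟩
      hi - lo - 1ℤ                        ∎
      where open ≡-Reasoning
    window : (∃ λ j → j ℕ.≤ N ℕ.+ N × lo + 1ℤ ≡ + j - + N) →
             (∃ λ j → j ℕ.≤ N ℕ.+ N × hi - 1ℤ ≡ + j - + N) →
             + length (filter P? (within N)) ≡ (hi - lo - 1ℤ) ⊔ 0ℤ
    window (j , _ , first) (j' , j'≤2N , last)
      with w , refl ← ℕₚ.m≤n⇒∃[o]m+o≡n {j} {j'} (ℤₚ.drop‿+≤+ (ordered {z = + N} first last))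
         | r , total ← ℕₚ.m≤n⇒∃[o]m+o≡n j'≤2N =
      trans (cong +_ (count-in-window j w r P⇔ first last total))
        (trans (width {+ j} (+ w) {+ N} first last) (sym (ℤₚ.i≥j⇒i⊔j≡i (ℤₚ.<⇒≤ 0<w))))

-- Counting the integers that make a product of two linear factors negative

opposite-signs : ∀ i j → i * j < 0ℤ → (0ℤ < i × j < 0ℤ) ⊎ (i < 0ℤ × 0ℤ < j)
opposite-signs (+ 0)      j          (ℤ.+<+ ())
opposite-signs (+ suc m)  (+ 0)      h rewrite ℤₚ.*-zeroʳ (+ suc m) with ℤ.+<+ () ← h
opposite-signs (+ suc m)  (+ suc n)  (ℤ.+<+ ())
opposite-signs (+ suc m)  -[1+ n ]   h = inj₁ (ℤ.+<+ ℕ.z<s , ℤ.-<+)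
opposite-signs (-[1+ m ]) (+ 0)      h rewrite ℤₚ.*-zeroʳ -[1+ m ] with ℤ.+<+ () ← h
opposite-signs (-[1+ m ]) (+ suc n)  h = inj₂ (ℤ.-<+ , ℤ.+<+ ℕ.z<s)
opposite-signs (-[1+ m ]) -[1+ n ]   (ℤ.+<+ ())

pos*neg<0 : ∀ {i j} → 0ℤ < i → j < 0ℤ → i * j < 0ℤ
pos*neg<0 {+ 0}     {_}        (ℤ.+<+ ()) _
pos*neg<0 {+ suc _} {+ _}      _ (ℤ.+<+ ())
pos*neg<0 {+ suc _} { -[1+ _ ]} _ _ = ℤ.-<+

module _ {m n : ℕ} .{{_ : NonZero m}} .{{_ : NonZero n}} where

  product<0 : ∀ x y k → (x - k * + m) * (y - k * + n) < 0ℤ ⇔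
    ((⌊ y / n ⌋ < k × k < ⌈ x / m ⌉) ⊎ (⌊ x / m ⌋ < k × k < ⌈ y / n ⌉))
  product<0 x y k = mk⇔ to from
    where
    positive : ∀ {i j} → 0ℤ < i - j → j < i
    positive {i} {j} h = gap< h ∴< solve (i ∷ j ∷ [])
    positive⁻¹ : ∀ {i j} → j < i → 0ℤ < i - j
    positive⁻¹ {i} {j} h = gap< h ∴< solve (i ∷ j ∷ [])
    negative : ∀ {i j} → i - j < 0ℤ → i < j
    negative {i} {j} h = gap< h ∴< solve (i ∷ j ∷ [])
    negative⁻¹ : ∀ {i j} → i < j → i - j < 0ℤ
    negative⁻¹ {i} {j} h = gap< h ∴< solve (i ∷ j ∷ [])
    to : (x - k * + m) * (y - k * + n) < 0ℤ → _
    to h with opposite-signs (x - k * + m) (y - k * + n) h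
    ... | inj₁ (u , v) = inj₁ (<*⇒⌊⌋< y k (negative v) , *<⇒<⌈⌉ x k (positive u))
    ... | inj₂ (u , v) = inj₂ (<*⇒⌊⌋< x k (negative u) , *<⇒<⌈⌉ y k (positive v))
    from : _ → (x - k * + m) * (y - k * + n) < 0ℤ
    from (inj₁ (u , v)) = pos*neg<0 (positive⁻¹ (<⌈⌉⇒*< x k v)) (negative⁻¹ (⌊⌋<⇒<* y k u))
    from (inj₂ (u , v)) = subst (_< 0ℤ) (ℤₚ.*-comm (y - k * + n) (x - k * + m))
      (pos*neg<0 (positive⁻¹ (<⌈⌉⇒*< y k v)) (negative⁻¹ (⌊⌋<⇒<* x k u)))

  between⇒0<excess : ∀ x y {k} → ⌊ y / n ⌋ < k × k < ⌈ x / m ⌉ → 0ℤ < excess x m y n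
  between⇒0<excess x y {k} (u , v) = lemma ⌊ y / n ⌋ ⌈ x / m ⌉ u v
    where
    lemma : ∀ f c → f < k → k < c → 0ℤ < c - f - 1ℤ
    lemma f c h h' = gap< h ⊞ gap< h' ∴< solve (f ∷ c ∷ k ∷ [])

module _ {m n : ℕ} .{{_ : NonZero m}} .{{_ : NonZero n}} where

  -- An alternative of `product<0` that has a solution forces its excess to be positive, and the two
  -- excesses have sum at most 0. So only one alternative ever contributes, and the sign of the
  -- first excess tells which interval to count.
  count-product<0 : ∀ {ℓ} {P : Pred ℤ ℓ} (P? : Decidable P) N x y →
    (∀ {k} → P k ⇔ (x - k * + m) * (y - k * + n) < 0ℤ) →
    (∀ {k} → P k → k ∈ within N) →
    + length (filter P? (within N)) ≡
      valley (excess x m y n) (excess y n x m)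
  count-product<0 {P = P} P? N x y P⇔ P⇒∈ with <⊎≥ 0ℤ (excess x m y n)
  ... | inj₁ 0<A = begin
      + length (filter P? (within N))
        ≡⟨ count-between P? N ⌊ y / n ⌋ ⌈ x / m ⌉
             (mk⇔ (only ∘ to (product<0 x y _) ∘ to P⇔)
                  (from P⇔ ∘ from (product<0 x y _) ∘ inj₁)) P⇒∈ ⟩
      excess x m y n ⊔ 0ℤ
        ≡⟨ ℤₚ.i≥j⇒i⊔j≡i (ℤₚ.<⇒≤ 0<A) ⟩
      excess x m y n
        ≡⟨ valley-right (excess x m y n) (excess y n x m) (excess-sum≤0 x y) (ℤₚ.<⇒≤ 0<A) ⟨
      valley (excess x m y n) (excess y n x m) ∎
    where
    open ≡-Reasoning
    open Equivalence using (to; from)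
    clash : ∀ A B → A + B ≤ 0ℤ → 0ℤ < A → ¬ 0ℤ < B
    clash A B s a b = ℤₚ.<⇒≱ (ℤₚ.+-mono-< a b) s
    only : ∀ {k} → (⌊ y / n ⌋ < k × k < ⌈ x / m ⌉) ⊎ (⌊ x / m ⌋ < k × k < ⌈ y / n ⌉) →
           ⌊ y / n ⌋ < k × k < ⌈ x / m ⌉
    only (inj₁ h) = h
    only (inj₂ h) = contradiction (between⇒0<excess y x h)
      (clash (excess x m y n) (excess y n x m) (excess-sum≤0 x y) 0<A)
  ... | inj₂ A≤0 = begin
      + length (filter P? (within N))
        ≡⟨ count-between P? N ⌊ x / m ⌋ ⌈ y / n ⌉
             (mk⇔ (only ∘ to (product<0 x y _) ∘ to P⇔)
                  (from P⇔ ∘ from (product<0 x y _) ∘ inj₂)) P⇒∈ ⟩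
      excess y n x m ⊔ 0ℤ
        ≡⟨ ℤₚ.+-identityˡ _ ⟨
      0ℤ + (excess y n x m ⊔ 0ℤ)
        ≡⟨ cong (_+ (excess y n x m ⊔ 0ℤ)) (ℤₚ.i≤j⇒i⊔j≡j A≤0) ⟨
      valley (excess x m y n) (excess y n x m) ∎
    where
    open ≡-Reasoning
    open Equivalence using (to; from)
    only : ∀ {k} → (⌊ y / n ⌋ < k × k < ⌈ x / m ⌉) ⊎ (⌊ x / m ⌋ < k × k < ⌈ y / n ⌉) →
           ⌊ x / m ⌋ < k × k < ⌈ y / n ⌉
    only (inj₁ h) = contradiction A≤0 (ℤₚ.<⇒≱ (between⇒0<excess x y h))
    only (inj₂ h) = h

-- Finite sums

sumℤ-+ : ∀ m {n} (f : Fin (m ℕ.+ n) → ℤ) → sumℤ f ≡ sumℤ (f ∘ (_↑ˡ n)) + sumℤ (f ∘ (m ↑ʳ_))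
sumℤ-+ 0       f = sym (ℤₚ.+-identityˡ (sumℤ f))
sumℤ-+ (suc m) f = trans (cong (λ z → f Fin.zero + z) (sumℤ-+ m (f ∘ Fin.suc))) (sym (ℤₚ.+-assoc (f Fin.zero) _ _))

sumℤ-telescope : ∀ n (g : ℕ → ℤ) →
  sumℤ {n} (g ∘ suc ∘ toℕ) + g 0 ≡ sumℤ {n} (g ∘ toℕ) + g n
sumℤ-telescope 0       g = refl
sumℤ-telescope (suc n) g = begin
  g 1 + S₂ + g 0          ≡⟨ move (g 0) (g 1) S₂ ⟩
  g 0 + (S₂ + g 1)        ≡⟨ cong (λ z → g 0 + z) (sumℤ-telescope n (g ∘ suc)) ⟩
  g 0 + (S₁ + g (suc n))  ≡⟨ ℤₚ.+-assoc (g 0) S₁ (g (suc n)) ⟨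
  g 0 + S₁ + g (suc n)    ∎
  where
  open ≡-Reasoning
  S₁ S₂ : ℤ
  S₁ = sumℤ {n} (g ∘ suc ∘ toℕ)
  S₂ = sumℤ {n} (g ∘ suc ∘ suc ∘ toℕ)
  move : ∀ a b c → b + c + a ≡ a + (c + b)
  move = solve-∀

-- Valleys along a twist orbit

module SlidingValley {A B : ℤ} (A+B≤0 : A + B ≤ 0ℤ) {f : ℤ → ℤ}
                     (f≡valley : ∀ k → f k ≡ valley (A + k) (B - k)) where

  private
    sum≤0 : ∀ k → A + k + (B - k) ≤ 0ℤ
    sum≤0 k = gap A+B≤0 ∴≤ solve (A ∷ B ∷ k ∷ [])

  falls : ∀ k → k ≤ B → f k ≡ B - k
  falls k k≤B = trans (f≡valley k) (valley-left (A + k) (B - k) (sum≤0 k) (gap k≤B))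

  rises : ∀ k → - A ≤ k → f k ≡ A + k
  rises k -A≤k = trans (f≡valley k)
    (valley-right (A + k) (B - k) (sum≤0 k) (gap -A≤k ∴≤ solve (A ∷ k ∷ [])))

  vanishes : ∀ k → B ≤ k → k ≤ - A → f k ≡ 0ℤ
  vanishes k B≤k k≤-A = trans (f≡valley k) (valley-bottom (A + k) (B - k)
    (gap k≤-A ∴≤ solve (A ∷ k ∷ [])) (gap B≤k ∴≤ solve (B ∷ k ∷ [])))

  step-right : ∀ k → - A ≤ k → f (k + 1ℤ) ≡ f k + 1ℤ
  step-right k -A≤k = begin
    f (k + 1ℤ)   ≡⟨ rises (k + 1ℤ) (ℤₚ.≤-trans -A≤k (ℤₚ.i≤i+j k 1ℤ)) ⟩
    A + (k + 1ℤ) ≡⟨ ℤₚ.+-assoc A k 1ℤ ⟨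
    A + k + 1ℤ   ≡⟨ cong (_+ 1ℤ) (rises k -A≤k) ⟨
    f k + 1ℤ     ∎
    where open ≡-Reasoning

  step-left : ∀ k → k ≤ B → f (k - 1ℤ) ≡ f k + 1ℤ
  step-left k k≤B = begin
    f (k - 1ℤ)   ≡⟨ falls (k - 1ℤ) (ℤₚ.≤-trans (ℤₚ.i-j≤i k 1ℤ) k≤B) ⟩
    B - (k - 1ℤ) ≡⟨ solve (B ∷ k ∷ []) ⟩
    B - k + 1ℤ   ≡⟨ cong (_+ 1ℤ) (falls k k≤B) ⟨
    f k + 1ℤ     ∎
    where open ≡-Reasoning

  -- The break points are the zeros of `B - k` and `A + k`. Neighbouring formulas agree there, so
  -- every single step is computed with one formula at both of its ends.
  vShaped : VShaped f
  vShaped = B , - A , (gap A+B≤0 ∴≤ solve (A ∷ B ∷ []))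
    , (λ k k<B → begin
        f (k + 1ℤ)     ≡⟨ falls (k + 1ℤ) (subst (_≤ B) (ℤₚ.+-comm 1ℤ k) (ℤₚ.i<j⇒suc[i]≤j k<B)) ⟩
        B - (k + 1ℤ)   ≡⟨ solve (B ∷ k ∷ []) ⟩
        B - k - 1ℤ     ≡⟨ cong (_- 1ℤ) (falls k (ℤₚ.<⇒≤ k<B)) ⟨
        f k - 1ℤ       ∎)
    , (λ k B≤k k<-A → trans
        (vanishes (k + 1ℤ) (ℤₚ.≤-trans B≤k (ℤₚ.i≤i+j k 1ℤ))
          (subst (_≤ - A) (ℤₚ.+-comm 1ℤ k) (ℤₚ.i<j⇒suc[i]≤j k<-A)))
        (sym (vanishes k B≤k (ℤₚ.<⇒≤ k<-A))))
    , step-right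
    where open ≡-Reasoning

-- Representatives of the peripheral arcs modulo deck transformations

module _ {ℓ} {X : Set ℓ} (r : ℕ) (peripheral : (a : ℤ) (l : ℕ) → 2 ℕ.≤ l → l ℕ.≤ r → X) where

  private
    -- A peripheral arc stores proofs of the bounds on its length, so an enumeration has to decide
    -- these bounds and drop the lengths that violate them.
    ofLength : ℤ → ℕ → List X
    ofLength a l with 2 ℕ.≤? l | l ℕ.≤? r
    ... | yes 2≤l | yes l≤r = [ peripheral a l 2≤l l≤r ]
    ... | _       | _       = []

    ∈-ofLength : ∀ a l 2≤l l≤r → peripheral a l 2≤l l≤r ∈ ofLength a l
    ∈-ofLength a l 2≤l l≤r with 2 ℕ.≤? l | l ℕ.≤? r
    -- The listed arc carries the proofs found by the decision procedure; it equals the given one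
    -- since proofs of `≤` are unique.
    ... | yes 2≤l' | yes l≤r' =
            here (cong₂ (peripheral a l) (ℕₚ.≤-irrelevant 2≤l 2≤l') (ℕₚ.≤-irrelevant l≤r l≤r'))
    ... | yes _    | no l≰r   = contradiction l≤r l≰r
    ... | no 2≰l   | _        = contradiction 2≤l 2≰l

  arcsAtOnePeriod : List X
  arcsAtOnePeriod = concatMap (λ a → concatMap (ofLength (+ a)) (upTo (suc r))) (upTo r)

  ∈-arcsAtOnePeriod : ∀ {a} → a ℕ.< r → ∀ l 2≤l l≤r →
                      peripheral (+ a) l 2≤l l≤r ∈ arcsAtOnePeriod
  ∈-arcsAtOnePeriod {a} a<r l 2≤l l≤r =
    ∈-concatMap⁺ (λ a → concatMap (ofLength (+ a)) (upTo (suc r))) (lose (∈-upTo⁺ a<r)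
      (∈-concatMap⁺ (ofLength (+ a)) (lose (∈-upTo⁺ (ℕ.s≤s l≤r)) (∈-ofLength (+ a) l 2≤l l≤r))))

reduce-mod : ∀ a r .{{_ : NonZero r}} → a + - ⌊ a / r ⌋ * + r ≡ + (a %ℕ r)
reduce-mod a r = trans (cong (_+ - ⌊ a / r ⌋ * + r) (a≡a%ℕn+[a/ℕn]*n a r))
    (cancel (+ (a %ℕ r)) ⌊ a / r ⌋ (+ r))
  where
  cancel : ∀ x g r → x + g * r + - g * r ≡ x
  cancel = solve-∀

-- Integer points of the lines parallel to the diagonal

OnLine-neg : ∀ d u v → OnLine d (u , v) → OnLine (- d) (- u , - v)
OnLine-neg d u v e = trans (negate u v) (cong -_ e)
  where
  negate : ∀ u v → - u - - v ≡ - (u - v)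
  negate = solve-∀

OnLine-swap : ∀ d u v → OnLine d (u , v) → OnLine (- d) (v , u)
OnLine-swap d u v e = trans (negate u v) (cong -_ e)
  where
  negate : ∀ u v → v - u ≡ - (u - v)
  negate = solve-∀

-- The line is cut between its neighbouring points (1 , 0) and (0 , -1): points of the first kind
-- will be projections of dimension vectors, points of the second kind projections of their
-- negatives.
data PointOnLine₁ : ℤ × ℤ → Set where
  positive : ∀ n → PointOnLine₁ (+ suc n , + n)
  negative : ∀ n → PointOnLine₁ (- + n , - + suc n)

pointOnLine₁ : ∀ w → OnLine 1ℤ w → PointOnLine₁ w
pointOnLine₁ (u , v) e = subst (λ u → PointOnLine₁ (u , v)) (sym u≡1+v) (at v)
  where
  u≡1+v : u ≡ 1ℤ + v
  u≡1+v = trans (restore u v) (cong (_+ v) e)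
    where
    restore : ∀ u v → u ≡ u - v + v
    restore = solve-∀
  at : ∀ v → PointOnLine₁ (1ℤ + v , v)
  at (+ n)          = positive n
  at -[1+ 0 ]       = negative 0
  at -[1+ suc n ]   = negative (suc n)

-- Crossings with the fan triangulation

module FanTriangulation (p q : ℕ) .{{_ : NonZero p}} .{{_ : NonZero q}} where
  open Annulus p q

  vertex-toℕ : ∀ i → vertex (toℕ i) ≡ i
  vertex-toℕ i = Finₚ.toℕ-injective
    (trans (Finₚ.toℕ-fromℕ< _) (DivMod.m<n⇒m%n≡m (Finₚ.toℕ<n i)))

  -- As `δ` is constantly 1, the Euler form is the sum of `x` over the vertices minus its sum over
  -- the targets of arrows. The targets of the inner arrows are the vertices with index at least `p`
  -- and cancel; the targets of the outer arrows are the vertices 1, ..., `p`, compared with 0, ...,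
  -- `p - 1`, and the sum telescopes.
  ∂-difference : ∀ x → ∂ x ≡ x s - x t
  ∂-difference x = begin
    ∂ x
      ≡⟨ cong₂ _-_ (Sum.sum-cong-≗ {p ℕ.+ q} vertices)
           (Sum.sum-cong-≗ {p ℕ.+ q} λ α → ℤₚ.*-identityˡ (x (tgt α))) ⟩
    sumℤ {p ℕ.+ q} (y ∘ toℕ) - sumℤ (x ∘ tgt)
      ≡⟨ cong₂ _-_ (sumℤ-+ p {q} (y ∘ toℕ)) (sumℤ-+ p {q} (x ∘ tgt)) ⟩
    sumℤ {p} (λ j → y (toℕ (j ↑ˡ q))) + sumℤ {q} (λ j → y (toℕ (p ↑ʳ j)))
      - (sumℤ {p} (λ j → x (tgt (j ↑ˡ q))) + sumℤ {q} (λ j → x (tgt (p ↑ʳ j))))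
      ≡⟨ cong₂ _-_
           (cong₂ _+_ (Sum.sum-cong-≗ {p} λ j → cong y (Finₚ.toℕ-↑ˡ j q))
                      (Sum.sum-cong-≗ {q} λ j → cong y (Finₚ.toℕ-↑ʳ p j)))
           (cong₂ _+_ (Sum.sum-cong-≗ {p} λ j → cong (x ∘ head) (Finₚ.splitAt-↑ˡ p j q))
                      (Sum.sum-cong-≗ {q} λ j → cong (x ∘ head) (Finₚ.splitAt-↑ʳ p q j))) ⟩
    outer₀ + inner₀ - (outer₁ + inner₀)
      ≡⟨ cancel outer₀ outer₁ inner₀ (y 0) (y p) (sumℤ-telescope p y) ⟩
    x s - x t ∎
    where
    open ≡-Reasoning
    open Quiver Q using (tgt)
    y : ℕ → ℤ
    y = x ∘ vertex
    head : Fin p ⊎ Fin q → Fin (p ℕ.+ q)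
    head = [ (λ j → vertex (suc (toℕ j))) , (λ j → vertex (p ℕ.+ toℕ j)) ]′
    outer₀ outer₁ inner₀ : ℤ
    outer₀ = sumℤ {p} (y ∘ toℕ)
    outer₁ = sumℤ {p} (y ∘ suc ∘ toℕ)
    inner₀ = sumℤ {q} (λ j → y (p ℕ.+ toℕ j))
    vertices : ∀ i → 1ℤ * x i ≡ y (toℕ i)
    vertices i = trans (ℤₚ.*-identityˡ (x i)) (cong x (sym (vertex-toℕ i)))
    cancel : ∀ a b c u v → b + u ≡ a + v → a + c - (b + c) ≡ u - v
    cancel a b c u v e = begin
      a + c - (b + c)      ≡⟨ solve (a ∷ b ∷ c ∷ u ∷ v ∷ []) ⟩
      (a + v) - b - v      ≡⟨ cong (λ w → w - b - v) e ⟨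
      (b + u) - b - v      ≡⟨ solve (b ∷ u ∷ v ∷ []) ⟩
      u - v                ∎

  τ-s : τ s ≡ bridging 0ℤ 0ℤ
  τ-s = τ-< (ℕ.>-nonZero⁻¹ p)

  τ-t : τ t ≡ bridging (+ p) 0ℤ
  τ-t = trans (cong (τ ∘ vertex) (sym (ℕₚ.+-identityʳ p))) (τ-≥ (ℕ.>-nonZero⁻¹ q))

  data InFan (γ : Arc) : Set where
    outerFan : ∀ {j} → j ℕ.< p → γ ≡ bridging (+ j) 0ℤ → InFan γ
    innerFan : ∀ {j} → j ℕ.< q → γ ≡ bridging (+ p) (+ j) → InFan γ

  τ-inFan : ∀ i → InFan (τ i)
  τ-inFan i with splitAt p i
  ... | inj₁ j = outerFan (Finₚ.toℕ<n j) refl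
  ... | inj₂ j = innerFan (Finₚ.toℕ<n j) refl

  -- The numbers A and B for crossings with the arc (0 , 0), named after their behaviour under
  -- positive twists. For another bridging arc (c , d) they are taken at `a - c` and `b - d`.
  rising falling : ℤ → ℤ → ℤ
  rising  a b = excess a p b q
  falling a b = excess b q a p

  crossings-bridging : ∀ a b c d →
    + i⟨ bridging a b , bridging c d ⟩ ≡ valley (rising (a - c) (b - d)) (falling (a - c) (b - d))
  crossings-bridging a b c d = count-product<0
      (λ k → crosses? (bridging a b) (deck k (bridging c d)))
      (size (bridging a b) ℕ.+ size (bridging c d)) (a - c) (b - d)
      (λ {k} → mk⇔ (subst (_< 0ℤ) (eq a b c d k (+ p) (+ q)))
                    (subst (_< 0ℤ) (sym (eq a b c d k (+ p) (+ q)))))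
      (λ {k} → crossings-in-interval (bridging a b) (bridging c d) k)
    where
    eq : ∀ a b c d k p q →
         (a - (c + k * p)) * (b - (d + k * q)) ≡ (a - c - k * p) * (b - d - k * q)
    eq = solve-∀

  -- The inner end of a bridging arc always lies on the positive side of an outer peripheral arc, so
  -- the outer end alone decides, and both fractions have denominator `p`.
  crossings-peripheralOuter : ∀ a l m n c d →
    + i⟨ peripheralOuter a l m n , bridging c d ⟩ ≡
      valley (excess (a - c) p (a + + l - c) p) (excess (a + + l - c) p (a - c) p)
  crossings-peripheralOuter a l m n c d = count-product<0
      (λ k → crosses? (peripheralOuter a l m n) (deck k (bridging c d)))
      (size (peripheralOuter a l m n) ℕ.+ size (bridging c d)) (a - c) (a + + l - c)
      (λ {k} → mk⇔ (subst (_< 0ℤ) (eq a (+ l) c k (+ p)))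
                    (subst (_< 0ℤ) (sym (eq a (+ l) c k (+ p)))))
      (λ {k} → crossings-in-interval (peripheralOuter a l m n) (bridging c d) k)
    where
    eq : ∀ a l c k p →
         (a - (c + k * p)) * (a + l - (c + k * p)) * 1ℤ ≡ (a - c - k * p) * (a + l - c - k * p)
    eq = solve-∀

  crossings-peripheralInner : ∀ b l m n c d →
    + i⟨ peripheralInner b l m n , bridging c d ⟩ ≡
      valley (excess (b - d) q (b + + l - d) q) (excess (b + + l - d) q (b - d) q)
  crossings-peripheralInner b l m n c d = count-product<0
      (λ k → crosses? (peripheralInner b l m n) (deck k (bridging c d)))
      (size (peripheralInner b l m n) ℕ.+ size (bridging c d)) (b - d) (b + + l - d)
      (λ {k} → mk⇔ (subst (_< 0ℤ) (eq b (+ l) d k (+ q)))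
                    (subst (_< 0ℤ) (sym (eq b (+ l) d k (+ q)))))
      (λ {k} → crossings-in-interval (peripheralInner b l m n) (bridging c d) k)
    where
    eq : ∀ b l d k q →
         1ℤ * ((b - (d + k * q)) * (b + l - (d + k * q))) ≡ (b - d - k * q) * (b + l - d - k * q)
    eq = solve-∀

  private
    +0* : ∀ b r → b + 0ℤ * r ≡ b
    +0* = solve-∀

    +-1* : ∀ a r → a - 0ℤ + -1ℤ * r ≡ a - r
    +-1* = solve-∀

  -- Twists, deck transformations and the bridging arcs in T

  rising-twist : ∀ a b k → rising (a + k * + p) b ≡ rising a b + k
  rising-twist a b k = begin
    rising (a + k * + p) b                  ≡⟨ cong (rising (a + k * + p)) (+0* b (+ q)) ⟨
    rising (a + k * + p) (b + 0ℤ * + q)     ≡⟨ excess-shift a b k 0ℤ ⟩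
    rising a b + (k - 0ℤ)                   ≡⟨ cong (λ j → rising a b + j) (ℤₚ.+-identityʳ k) ⟩
    rising a b + k                          ∎
    where open ≡-Reasoning

  falling-twist : ∀ a b k → falling (a + k * + p) b ≡ falling a b - k
  falling-twist a b k = begin
    falling (a + k * + p) b                 ≡⟨ cong (falling (a + k * + p)) (+0* b (+ q)) ⟨
    falling (a + k * + p) (b + 0ℤ * + q)    ≡⟨ excess-shift b a 0ℤ k ⟩
    falling a b + (0ℤ - k)                  ≡⟨ cong (λ j → falling a b + j) (ℤₚ.+-identityˡ (- k)) ⟩
    falling a b - k                         ∎
    where open ≡-Reasoning

  rising-deck : ∀ a b k → rising (a + k * + p) (b + k * + q) ≡ rising a b
  rising-deck a b k = trans (excess-shift a b k k)
    (trans (cong (λ j → rising a b + j) (ℤₚ.+-inverseʳ k)) (ℤₚ.+-identityʳ (rising a b)))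

  falling-deck : ∀ a b k → falling (a + k * + p) (b + k * + q) ≡ falling a b
  falling-deck a b k = trans (excess-shift b a k k)
    (trans (cong (λ j → falling a b + j) (ℤₚ.+-inverseʳ k)) (ℤₚ.+-identityʳ (falling a b)))

  rising+falling≤0 : ∀ a b → rising a b + falling a b ≤ 0ℤ
  rising+falling≤0 a b = excess-sum≤0 a b

  private
    ≤1* : ∀ {j r} → j ℕ.≤ r → + j ≤ 1ℤ * + r
    ≤1* {r = r} j≤r = subst (_ ≤_) (sym (ℤₚ.*-identityˡ (+ r))) (ℤ.+≤+ j≤r)

    1*≤ : ∀ r → 1ℤ * + r ≤ + r
    1*≤ r = ℤₚ.≤-reflexive (ℤₚ.*-identityˡ (+ r))

  inFan⇒bottom : ∀ {a b} → InFan (bridging a b) → rising a b ≤ 0ℤ × falling a b ≤ -1ℤ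
  inFan⇒bottom (outerFan {j} j<p refl) =
      excess-≤ (+ j) 0ℤ 1ℤ 0ℤ (≤1* (ℕₚ.<⇒≤ j<p)) ℤₚ.≤-refl
    , excess-≤ 0ℤ (+ j) 0ℤ 0ℤ ℤₚ.≤-refl (ℤ.+≤+ ℕ.z≤n)
  inFan⇒bottom (innerFan {j} j<q refl) =
      excess-≤ (+ p) (+ j) 1ℤ 0ℤ (≤1* ℕₚ.≤-refl) (ℤ.+≤+ ℕ.z≤n)
    , excess-≤ (+ j) (+ p) 1ℤ 1ℤ (≤1* (ℕₚ.<⇒≤ j<q)) (1*≤ p)

  inT⇒bottom : ∀ a b → InT (bridging a b) → rising a b ≤ 0ℤ × falling a b ≤ -1ℤ
  inT⇒bottom a b (i , k , eq) with inFan⇒bottom (subst InFan (sym eq) (τ-inFan i))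
  ... | A≤0 , B<0 = subst (_≤ 0ℤ) (rising-deck a b k) A≤0
                  , subst (_≤ -1ℤ) (falling-deck a b k) B<0

  -- Translate by the deck transformation that brings `b` into [0 , q). The hypotheses read
  -- `⌈ a / p ⌉ ≤ 1 + ⌊ b / q ⌋` and `⌈ b / q ⌉ ≤ ⌊ a / p ⌋`, which places the translate `a'` of `a`
  -- in [0 , p].
  bottom⇒inT : ∀ a b → rising a b ≤ 0ℤ → falling a b ≤ -1ℤ → InT (bridging a b)
  bottom⇒inT a b A≤0 B<0 with <⊎≥ (a + - ⌊ b / q ⌋ * + p) (+ p)
  -- Here `⌊ a / p ⌋` is at most `g`, so `⌈ b / q ⌉ ≤ g`: the inner end point is translated to 0 and
  -- the arc is in the outer fan.
  ... | inj₁ a'<p = vertex ∣ a' ∣ , - g ,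
        trans (cong₂ bridging (sym a'≡) b'≡0) (sym (τ-< (ℤₚ.drop‿+<+ (subst (_< + p) (sym a'≡) a'<p))))
    where
    g a' : ℤ
    g = ⌊ b / q ⌋
    a' = a + - g * + p
    ⌈b⌉≤⌊a⌋ : ⌈ b / q ⌉ ≤ ⌊ a / p ⌋
    ⌈b⌉≤⌊a⌋ = lemma ⌈ b / q ⌉ ⌊ a / p ⌋ B<0
      where
      lemma : ∀ c f → c - f - 1ℤ ≤ -1ℤ → c ≤ f
      lemma c f h = gap h ∴≤ solve (c ∷ f ∷ [])
    ⌊a⌋≤g : ⌊ a / p ⌋ ≤ g
    ⌊a⌋≤g = lemma ⌊ a / p ⌋ g (<*⇒⌊⌋< a (1ℤ + g) (shift g (+ p) a'<p))
      where
      lemma : ∀ f g → f < 1ℤ + g → f ≤ g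
      lemma f g h = gap< h ∴≤ solve (f ∷ g ∷ [])
      shift : ∀ g p → a + - g * p < p → a < (1ℤ + g) * p
      shift g p h = gap< h ∴< solve (a ∷ g ∷ p ∷ [])
    0≤a' : 0ℤ ≤ a'
    0≤a' = shift g (+ p) (≤⌊⌋⇒*≤ a g (ℤₚ.≤-trans (⌊⌋≤⌈⌉ b) ⌈b⌉≤⌊a⌋))
      where
      shift : ∀ g p → g * p ≤ a → 0ℤ ≤ a + - g * p
      shift g p h = gap h ∴≤ solve (a ∷ g ∷ p ∷ [])
    a'≡ : + ∣ a' ∣ ≡ a'
    a'≡ = ℤₚ.0≤i⇒+∣i∣≡i 0≤a'
    b'≡0 : b + - g * + q ≡ 0ℤ
    b'≡0 = ℤₚ.≤-antisym
        (below g (+ q) (⌈⌉≤⇒≤* b g (ℤₚ.≤-trans ⌈b⌉≤⌊a⌋ ⌊a⌋≤g)))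
        (above g (+ q) (≤⌊⌋⇒*≤ b g ℤₚ.≤-refl))
      where
      below : ∀ g q → b ≤ g * q → b + - g * q ≤ 0ℤ
      below g q h = gap h ∴≤ solve (b ∷ g ∷ q ∷ [])
      above : ∀ g q → g * q ≤ b → 0ℤ ≤ b + - g * q
      above g q h = gap h ∴≤ solve (b ∷ g ∷ q ∷ [])
  -- Now `a'` equals `p`, the inner end point may be any remainder modulo `q`, and the arc is in the
  -- inner fan.
  ... | inj₂ p≤a' = vertex (p ℕ.+ b %ℕ q) , - g ,
        trans (cong₂ bridging (ℤₚ.≤-antisym a'≤p p≤a') b'≡r) (sym (τ-≥ (n%ℕd<d b q)))
    where
    g a' : ℤ
    g = ⌊ b / q ⌋
    a' = a + - g * + p
    a'≤p : a' ≤ + p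
    a'≤p = shift g (+ p) (⌈⌉≤⇒≤* a (1ℤ + g) (lemma ⌈ a / p ⌉ g A≤0))
      where
      lemma : ∀ c f → c - f - 1ℤ ≤ 0ℤ → c ≤ 1ℤ + f
      lemma c f h = gap h ∴≤ solve (c ∷ f ∷ [])
      shift : ∀ g p → a ≤ (1ℤ + g) * p → a + - g * p ≤ p
      shift g p h = gap h ∴≤ solve (a ∷ g ∷ p ∷ [])
    b'≡r : b + - g * + q ≡ + (b %ℕ q)
    b'≡r = reduce-mod b q

  -- The thresholds differ because they refer to different arcs: `1 ≤ A` forces a crossing with s,
  -- while `0 ≤ B` forces one with t, for which the second excess is `B + 1`.
  data Location (a b : ℤ) : Set where
    inT      : InT (bridging a b) → Location a b
    rightArm : 1ℤ ≤ rising a b → Location a b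
    leftArm  : 0ℤ ≤ falling a b → Location a b

  locate : ∀ a b → Location a b
  locate a b with <⊎≥ 0ℤ (rising a b) | <⊎≥ -1ℤ (falling a b)
  ... | inj₁ 0<A | _         = rightArm (ℤₚ.i<j⇒suc[i]≤j 0<A)
  ... | inj₂ A≤0 | inj₁ -1<B = leftArm (ℤₚ.i<j⇒suc[i]≤j -1<B)
  ... | inj₂ A≤0 | inj₂ B≤-1 = inT (bottom⇒inT a b A≤0 B≤-1)

  rightArm⇒∉T : ∀ a b → 1ℤ ≤ rising a b → ¬ InT (bridging a b)
  rightArm⇒∉T a b 1≤A h = 1≰0 (ℤₚ.≤-trans 1≤A (proj₁ (inT⇒bottom a b h)))
    where
    1≰0 : ¬ 1ℤ ≤ 0ℤ
    1≰0 (ℤ.+≤+ ())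

  leftArm⇒∉T : ∀ a b → 0ℤ ≤ falling a b → ¬ InT (bridging a b)
  leftArm⇒∉T a b 0≤B h = 0≰-1 (ℤₚ.≤-trans 0≤B (proj₂ (inT⇒bottom a b h)))
    where
    0≰-1 : ¬ 0ℤ ≤ -1ℤ
    0≰-1 ()

  -- Crossings with s and t, and the defect

  crossings-s : ∀ a b → crossings (bridging a b) s ≡ valley (rising a b) (falling a b)
  crossings-s a b = begin
    + i⟨ bridging a b , τ s ⟩                    ≡⟨ cong (λ γ → + i⟨ bridging a b , γ ⟩) τ-s ⟩
    + i⟨ bridging a b , bridging 0ℤ 0ℤ ⟩         ≡⟨ crossings-bridging a b 0ℤ 0ℤ ⟩
    valley (rising (a - 0ℤ) (b - 0ℤ)) (falling (a - 0ℤ) (b - 0ℤ))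
      ≡⟨ cong₂ (λ a b → valley (rising a b) (falling a b)) (ℤₚ.+-identityʳ a) (ℤₚ.+-identityʳ b) ⟩
    valley (rising a b) (falling a b) ∎
    where open ≡-Reasoning

  -- Since t is the twist of s, crossing t amounts to crossing s after one inverse twist.
  crossings-t : ∀ a b → crossings (bridging a b) t ≡ valley (rising a b - 1ℤ) (falling a b + 1ℤ)
  crossings-t a b = begin
    + i⟨ bridging a b , τ t ⟩                    ≡⟨ cong (λ γ → + i⟨ bridging a b , γ ⟩) τ-t ⟩
    + i⟨ bridging a b , bridging (+ p) 0ℤ ⟩      ≡⟨ crossings-bridging a b (+ p) 0ℤ ⟩
    valley (rising (a - + p) (b - 0ℤ)) (falling (a - + p) (b - 0ℤ))
      ≡⟨ cong₂ (λ a b → valley (rising a b) (falling a b)) (eq a (+ p)) (ℤₚ.+-identityʳ b) ⟩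
    valley (rising (a + -1ℤ * + p) b) (falling (a + -1ℤ * + p) b)
      ≡⟨ cong₂ valley (rising-twist a b -1ℤ) (falling-twist a b -1ℤ) ⟩
    valley (rising a b - 1ℤ) (falling a b + 1ℤ) ∎
    where
    open ≡-Reasoning
    eq : ∀ a p → a - p ≡ a + -1ℤ * p
    eq = solve-∀

  private
    t-sum≤0 : ∀ A B → A + B ≤ 0ℤ → A - 1ℤ + (B + 1ℤ) ≤ 0ℤ
    t-sum≤0 A B h = gap h ∴≤ solve (A ∷ B ∷ [])

  rightArm-st : ∀ a b → 1ℤ ≤ rising a b →
    crossings (bridging a b) s ≡ rising a b × crossings (bridging a b) t ≡ rising a b - 1ℤ
  rightArm-st a b 1≤A =
      trans (crossings-s a b) (valley-right (rising a b) (falling a b) (rising+falling≤0 a b) (ℤₚ.≤-trans (ℤ.+≤+ ℕ.z≤n) 1≤A))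
    , trans (crossings-t a b) (valley-right (rising a b - 1ℤ) (falling a b + 1ℤ)
        (t-sum≤0 (rising a b) (falling a b) (rising+falling≤0 a b)) (gap 1≤A))

  leftArm-st : ∀ a b → 0ℤ ≤ falling a b →
    crossings (bridging a b) s ≡ falling a b × crossings (bridging a b) t ≡ falling a b + 1ℤ
  leftArm-st a b 0≤B =
      trans (crossings-s a b) (valley-left (rising a b) (falling a b) (rising+falling≤0 a b) 0≤B)
    , trans (crossings-t a b) (valley-left (rising a b - 1ℤ) (falling a b + 1ℤ)
        (t-sum≤0 (rising a b) (falling a b) (rising+falling≤0 a b))
        (ℤₚ.≤-trans 0≤B (ℤₚ.i≤i+j (falling a b) 1ℤ)))

  ∂-rightArm : ∀ a b → 1ℤ ≤ rising a b → ∂ (crossings (bridging a b)) ≡ 1ℤ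
  ∂-rightArm a b 1≤A = trans (∂-difference (crossings (bridging a b)))
      (trans (cong₂ _-_ (proj₁ (rightArm-st a b 1≤A)) (proj₂ (rightArm-st a b 1≤A)))
        (cancel (rising a b)))
    where
    cancel : ∀ A → A - (A - 1ℤ) ≡ 1ℤ
    cancel = solve-∀

  ∂-leftArm : ∀ a b → 0ℤ ≤ falling a b → ∂ (crossings (bridging a b)) ≡ -1ℤ
  ∂-leftArm a b 0≤B = trans (∂-difference (crossings (bridging a b)))
      (trans (cong₂ _-_ (proj₁ (leftArm-st a b 0≤B)) (proj₂ (leftArm-st a b 0≤B)))
        (cancel (falling a b)))
    where
    cancel : ∀ B → B - (B + 1ℤ) ≡ -1ℤ
    cancel = solve-∀

  ∂-peripheral : ∀ γ → Peripheral γ → ∂ (crossings γ) ≡ 0ℤ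
  ∂-peripheral (bridging _ _) ¬br = contradiction tt ¬br
  ∂-peripheral γ@(peripheralOuter a l m n) _ =
    trans (∂-difference (crossings γ)) (ℤₚ.i≡j⇒i-j≡0 (begin
      + i⟨ γ , τ s ⟩                     ≡⟨ cong (λ γ' → + i⟨ γ , γ' ⟩) τ-s ⟩
      + i⟨ γ , bridging 0ℤ 0ℤ ⟩          ≡⟨ crossings-peripheralOuter a l m n 0ℤ 0ℤ ⟩
      count (a - 0ℤ) (a + + l - 0ℤ)
        -- The outer end points of s and t differ by one period `p`, which moves both fractions by
        -- the same integer.
        ≡⟨ cong₂ valley (shift (a - 0ℤ) (a + + l - 0ℤ)) (shift (a + + l - 0ℤ) (a - 0ℤ)) ⟨
      count (a - 0ℤ + -1ℤ * + p) (a + + l - 0ℤ + -1ℤ * + p)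
        ≡⟨ cong₂ count (+-1* a (+ p)) (+-1* (a + + l) (+ p)) ⟩
      count (a - + p) (a + + l - + p)    ≡⟨ crossings-peripheralOuter a l m n (+ p) 0ℤ ⟨
      + i⟨ γ , bridging (+ p) 0ℤ ⟩       ≡⟨ cong (λ γ' → + i⟨ γ , γ' ⟩) τ-t ⟨
      + i⟨ γ , τ t ⟩                     ∎))
    where
    open ≡-Reasoning
    count : ℤ → ℤ → ℤ
    count x y = valley (excess x p y p) (excess y p x p)
    shift : ∀ x y → excess (x + -1ℤ * + p) p (y + -1ℤ * + p) p ≡ excess x p y p
    shift x y = trans (excess-shift x y -1ℤ -1ℤ) (ℤₚ.+-identityʳ (excess x p y p))
  ∂-peripheral γ@(peripheralInner b l m n) _ =
    trans (∂-difference (crossings γ)) (ℤₚ.i≡j⇒i-j≡0 (begin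
      + i⟨ γ , τ s ⟩                     ≡⟨ cong (λ γ' → + i⟨ γ , γ' ⟩) τ-s ⟩
      + i⟨ γ , bridging 0ℤ 0ℤ ⟩          ≡⟨ crossings-peripheralInner b l m n 0ℤ 0ℤ ⟩
      -- The count for an inner arc involves only the inner end point, which s and t share.
      valley (excess (b - 0ℤ) q (b + + l - 0ℤ) q) (excess (b + + l - 0ℤ) q (b - 0ℤ) q)
                                         ≡⟨ crossings-peripheralInner b l m n (+ p) 0ℤ ⟨
      + i⟨ γ , bridging (+ p) 0ℤ ⟩       ≡⟨ cong (λ γ' → + i⟨ γ , γ' ⟩) τ-t ⟨
      + i⟨ γ , τ t ⟩                     ∎))
    where open ≡-Reasoning

  -- By these two bounds each coordinate has reached its arm of slope ±1 once the
  -- defect is nonzero.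
  record OrbitValley (a b : ℤ) (i : Fin (p ℕ.+ q)) : Set where
    field
      A B        : ℤ
      rising-1≤A : rising a b - 1ℤ ≤ A
      falling≤B  : falling a b ≤ B
      A+B≤0      : A + B ≤ 0ℤ
      crossings≡ : ∀ k → crossings (bridging (a + k * + p) b) i ≡ valley (A + k) (B - k)

  -- The bound on `A` compares the arc (c , d) of T with (p , 0), as `c ≤ p` and `0 ≤ d`. The bound
  -- on `B` compares it with (0 , 0) in the outer fan and with the deck translate (p , q) in the
  -- inner fan.
  orbitValley : ∀ a b i → OrbitValley a b i
  orbitValley a b i = go (τ-inFan i)
    where
    at : ∀ c d → τ i ≡ bridging c d → c ≤ + p → 0ℤ ≤ d →
         falling a b ≤ falling (a - c) (b - d) → OrbitValley a b i
    at c d τ≡ c≤p 0≤d falling≤ = record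
      { A = rising (a - c) (b - d)
      ; B = falling (a - c) (b - d)
      ; rising-1≤A = subst (_≤ rising (a - c) (b - d)) (rising-twist a b -1ℤ)
          (excess-mono _ _ _ _ (left c (+ p) c≤p) (ℤₚ.≤-trans (down d 0≤d) ℤₚ.≤-refl))
      ; falling≤B = falling≤
      ; A+B≤0 = rising+falling≤0 (a - c) (b - d)
      ; crossings≡ = λ k → begin
          + i⟨ bridging (a + k * + p) b , τ i ⟩
            ≡⟨ cong (λ γ → + i⟨ bridging (a + k * + p) b , γ ⟩) τ≡ ⟩
          + i⟨ bridging (a + k * + p) b , bridging c d ⟩
            ≡⟨ crossings-bridging (a + k * + p) b c d ⟩
          valley (rising (a + k * + p - c) (b - d)) (falling (a + k * + p - c) (b - d))
            ≡⟨ cong (λ x → valley (rising x (b - d)) (falling x (b - d))) (slide (k * + p)) ⟩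
          valley (rising (a - c + k * + p) (b - d)) (falling (a - c + k * + p) (b - d))
            ≡⟨ cong₂ valley (rising-twist (a - c) (b - d) k) (falling-twist (a - c) (b - d) k) ⟩
          valley (rising (a - c) (b - d) + k) (falling (a - c) (b - d) - k) ∎
      }
      where
      open ≡-Reasoning
      slide : ∀ x → a + x - c ≡ a - c + x
      slide x = solve (a ∷ x ∷ c ∷ [])
      left : ∀ c p → c ≤ p → a + -1ℤ * p ≤ a - c
      left c p h = gap h ∴≤ solve (a ∷ c ∷ p ∷ [])
      down : ∀ d → 0ℤ ≤ d → b - d ≤ b
      down d h = gap h ∴≤ solve (b ∷ d ∷ [])
    go : InFan (τ i) → OrbitValley a b i
    go (outerFan {j} j<p τ≡) = at (+ j) 0ℤ τ≡ (ℤ.+≤+ (ℕₚ.<⇒≤ j<p)) ℤₚ.≤-refl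
      (excess-mono _ _ _ _ (ℤₚ.≤-reflexive (sym (ℤₚ.+-identityʳ b))) (ℤₚ.i-j≤i a (+ j)))
    go (innerFan {j} j<q τ≡) = at (+ p) (+ j) τ≡ ℤₚ.≤-refl (ℤ.+≤+ ℕ.z≤n)
      (subst (_≤ falling (a - + p) (b - + j)) (falling-deck a b -1ℤ)
        (excess-mono _ _ _ _ (up (+ j) (+ q) (ℤ.+≤+ (ℕₚ.<⇒≤ j<q))) (across (+ p))))
      where
      up : ∀ j q → j ≤ q → b + -1ℤ * q ≤ b - j
      up j q h = gap h ∴≤ solve (b ∷ j ∷ q ∷ [])
      across : ∀ p → a - p ≤ a + -1ℤ * p
      across p = ℤₚ.≤-reflexive (solve (a ∷ p ∷ []))

  crossings-vShaped : ∀ a b i → VShaped (λ k → crossings (bridging (a + k * + p) b) i)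
  crossings-vShaped a b i = SlidingValley.vShaped {A} {B} A+B≤0 crossings≡
    where open OrbitValley (orbitValley a b i)

  shift-rightArm : ∀ a b k → 1ℤ - rising a b ≤ k → ∀ i →
    crossings (bridging (a + (k + 1ℤ) * + p) b) i ≡ crossings (bridging (a + k * + p) b) i + 1ℤ
  shift-rightArm a b k k₊≤k i =
      SlidingValley.step-right {A} {B} A+B≤0 crossings≡ k (lemma (rising a b) A rising-1≤A k₊≤k)
    where
    open OrbitValley (orbitValley a b i)
    lemma : ∀ A₀ A → A₀ - 1ℤ ≤ A → 1ℤ - A₀ ≤ k → - A ≤ k
    lemma A₀ A h h' = gap h ⊞ gap h' ∴≤ solve (A₀ ∷ A ∷ k ∷ [])

  shift-leftArm : ∀ a b k → k ≤ falling a b → ∀ i →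
    crossings (bridging (a + (k - 1ℤ) * + p) b) i ≡ crossings (bridging (a + k * + p) b) i + 1ℤ
  shift-leftArm a b k k≤k₋ i =
      SlidingValley.step-left {A} {B} A+B≤0 crossings≡ k (ℤₚ.≤-trans k≤k₋ falling≤B)
    where open OrbitValley (orbitValley a b i)

  -- Peripheral arcs, the core curve and the trichotomy of arcs

  twist-peripheral : ∀ γ → Peripheral γ → twist γ ≈ γ
  twist-peripheral (bridging _ _) ¬br = contradiction tt ¬br
  twist-peripheral (peripheralOuter a l m n) _ =
      -1ℤ , cong (λ x → peripheralOuter x l m n) (untwist a (+ p))
    where
    untwist : ∀ a p → a + 1ℤ * p + -1ℤ * p ≡ a
    untwist = solve-∀
  twist-peripheral (peripheralInner b l m n) _ =
      0ℤ , cong (λ x → peripheralInner x l m n) (ℤₚ.+-identityʳ b)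

  peripheralArcs : List Arc
  peripheralArcs = arcsAtOnePeriod p peripheralOuter ++ arcsAtOnePeriod q peripheralInner

  -- Bridging arcs need no clause, as their crossing number with the core computes to 1. A
  -- peripheral arc is moved by the deck transformation that reduces its first end point to a
  -- remainder.
  core-disjoint-finite : ∀ γ → i⟨ γ ,core⟩ ≡ 0 → Any (γ ≈_) peripheralArcs
  core-disjoint-finite (peripheralOuter a l m n) _ = lose
    (∈-++⁺ˡ (∈-arcsAtOnePeriod p peripheralOuter (n%ℕd<d a p) l m n))
    (- ⌊ a / p ⌋ , cong (λ x → peripheralOuter x l m n) (reduce-mod a p))
  core-disjoint-finite (peripheralInner b l m n) _ = lose
    (∈-++⁺ʳ (arcsAtOnePeriod p peripheralOuter)
      (∈-arcsAtOnePeriod q peripheralInner (n%ℕd<d b q) l m n))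
    (- ⌊ b / q ⌋ , cong (λ x → peripheralInner x l m n) (reduce-mod b q))

  data Position (γ : Arc) : Set where
    peripheral : Peripheral γ → i⟨ γ ,core⟩ ≡ 0 → ∂ (crossings γ) ≡ 0ℤ → Position γ
    right      : Bridging γ → i⟨ γ ,core⟩ ≡ 1 → ∂ (crossings γ) ≡ 1ℤ → Position γ
    left       : Bridging γ → i⟨ γ ,core⟩ ≡ 1 → ∂ (crossings γ) ≡ -1ℤ → Position γ

  position : ∀ γ → ¬ InT γ → Position γ
  position (bridging a b) γ∉T = at (locate a b)
    where
    at : Location a b → Position (bridging a b)
    at (inT γ∈T)      = contradiction γ∈T γ∉T
    at (rightArm 1≤A) = right tt refl (∂-rightArm a b 1≤A)
    at (leftArm 0≤B)  = left tt refl (∂-leftArm a b 0≤B)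
  position γ@(peripheralOuter _ _ _ _) _ = peripheral (λ ()) refl (∂-peripheral γ (λ ()))
  position γ@(peripheralInner _ _ _ _) _ = peripheral (λ ()) refl (∂-peripheral γ (λ ()))

  -- The solutions of `1 ≤ A + k` and `0 ≤ B - k` for the exponent `k`. The exponents strictly
  -- between the two thresholds are those for which the twisted arc lies in T.
  firstRight lastLeft : ℤ → ℤ → ℤ
  firstRight a b = 1ℤ - rising a b
  lastLeft a b = falling a b

  last<first : ∀ a b → lastLeft a b < firstRight a b
  last<first a b = lemma (rising a b) (falling a b) (rising+falling≤0 a b)
    where
    lemma : ∀ A B → A + B ≤ 0ℤ → B < 1ℤ - A
    lemma A B h = gap h ∴< solve (A ∷ B ∷ [])

  first≤⇒rightArm : ∀ a b k → firstRight a b ≤ k → 1ℤ ≤ rising (a + k * + p) b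
  first≤⇒rightArm a b k h = subst (1ℤ ≤_) (sym (rising-twist a b k)) (lemma (rising a b) h)
    where
    lemma : ∀ A → 1ℤ - A ≤ k → 1ℤ ≤ A + k
    lemma A h = gap h ∴≤ solve (A ∷ k ∷ [])

  rightArm⇒first≤ : ∀ a b k → 1ℤ ≤ rising (a + k * + p) b → firstRight a b ≤ k
  rightArm⇒first≤ a b k h = lemma (rising a b) (subst (1ℤ ≤_) (rising-twist a b k) h)
    where
    lemma : ∀ A → 1ℤ ≤ A + k → 1ℤ - A ≤ k
    lemma A h = gap h ∴≤ solve (A ∷ k ∷ [])

  ≤last⇒leftArm : ∀ a b k → k ≤ lastLeft a b → 0ℤ ≤ falling (a + k * + p) b
  ≤last⇒leftArm a b k h = subst (0ℤ ≤_) (sym (falling-twist a b k)) (gap h)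

  leftArm⇒≤last : ∀ a b k → 0ℤ ≤ falling (a + k * + p) b → k ≤ lastLeft a b
  leftArm⇒≤last a b k h = ℤₚ.0≤i-j⇒j≤i (subst (0ℤ ≤_) (falling-twist a b k) h)

  π-right : ∀ a b n → π (crossings (bridging (a + (firstRight a b + + n) * + p) b)) ≡ (+ suc n , + n)
  π-right a b n = cong₂ _,_ (trans (proj₁ st) rising≡) (trans (proj₂ st) (cong (_- 1ℤ) rising≡))
    where
    k : ℤ
    k = firstRight a b + + n
    cancel : ∀ A n → A + (1ℤ - A + n) ≡ 1ℤ + n
    cancel = solve-∀
    rising≡ : rising (a + k * + p) b ≡ + suc n
    rising≡ = trans (rising-twist a b k) (cancel (rising a b) (+ n))
    st = rightArm-st (a + k * + p) b (first≤⇒rightArm a b k (ℤₚ.i≤i+j (firstRight a b) (+ n)))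

  π-left : ∀ a b n → π (crossings (bridging (a + (lastLeft a b - + n) * + p) b)) ≡ (+ n , + suc n)
  π-left a b n = cong₂ _,_ (trans (proj₁ st) falling≡)
      (trans (proj₂ st) (trans (cong (_+ 1ℤ) falling≡) (ℤₚ.+-comm (+ n) 1ℤ)))
    where
    k : ℤ
    k = lastLeft a b - + n
    cancel : ∀ B n → B - (B - n) ≡ n
    cancel = solve-∀
    falling≡ : falling (a + k * + p) b ≡ + n
    falling≡ = trans (falling-twist a b k) (cancel (falling a b) (+ n))
    st = leftArm-st (a + k * + p) b (≤last⇒leftArm a b k (ℤₚ.i-j≤i (lastLeft a b) (+ n)))

  orbit-arms : ∀ a b → ∃ λ k₀ →
    (∀ k → k₀ ≤ k →
      crossings (twist^ (k + 1ℤ) (bridging a b)) ≗ (λ i → crossings (twist^ k (bridging a b)) i + δ i) ×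
      ∂ (crossings (twist^ k (bridging a b))) ≡ 1ℤ) ×
    (∀ k → k ≤ - k₀ →
      crossings (twist^ (k - 1ℤ) (bridging a b)) ≗ (λ i → crossings (twist^ k (bridging a b)) i + δ i) ×
      ∂ (crossings (twist^ k (bridging a b))) ≡ -1ℤ)
  -- A single bound has to serve both ends of the orbit, as `k₀` on the right and as `- k₀` on the
  -- left.
  orbit-arms a b = firstRight a b ⊔ - lastLeft a b
    , (λ k k₀≤k → let k₊≤k = ℤₚ.≤-trans (ℤₚ.i≤i⊔j (firstRight a b) (- lastLeft a b)) k₀≤k in
        shift-rightArm a b k k₊≤k , ∂-rightArm (a + k * + p) b (first≤⇒rightArm a b k k₊≤k))
    , (λ k k≤-k₀ → let k≤k₋ = ℤₚ.≤-trans k≤-k₀ -k₀≤k₋ in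
        shift-leftArm a b k k≤k₋ , ∂-leftArm (a + k * + p) b (≤last⇒leftArm a b k k≤k₋))
    where
    -k₀≤k₋ : - (firstRight a b ⊔ - lastLeft a b) ≤ lastLeft a b
    -k₀≤k₋ = subst (- (firstRight a b ⊔ - lastLeft a b) ≤_) (ℤₚ.neg-involutive (lastLeft a b))
      (ℤₚ.neg-mono-≤ (ℤₚ.i≤j⊔i (firstRight a b) (- lastLeft a b)))

-- Exceptional modules and c-vectors

module ExceptionalModules {c ℓ₁ ℓ₂} (K : HeytingField c ℓ₁ ℓ₂)
    (p q : ℕ) .{{_ : NonZero p}} .{{_ : NonZero q}}
    (dictionary : AnnulusModules.Dictionary K p q)
    (cVectors : AnnulusModules.CVectorsOfQ K p q) where
  open AnnulusModules K p q
  open FanTriangulation p q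
  open Dictionary dictionary

  -- The two vectors agree only pointwise; `∂-difference` reduces the claim to the coordinates `s`
  -- and `t`.
  ∂-dimVec : ∀ {γ} (γ∉T : ¬ InT γ) → ∂ (dimVec M[ γ∉T ]) ≡ ∂ (crossings γ)
  ∂-dimVec {γ} γ∉T = begin
    ∂ (dimVec M[ γ∉T ])                    ≡⟨ ∂-difference (dimVec M[ γ∉T ]) ⟩
    dimVec M[ γ∉T ] s - dimVec M[ γ∉T ] t  ≡⟨ cong₂ _-_ (dimension γ∉T s) (dimension γ∉T t) ⟩
    crossings γ s - crossings γ t          ≡⟨ ∂-difference (crossings γ) ⟨
    ∂ (crossings γ)                        ∎
    where open ≡-Reasoning

  π-dimVec : ∀ {γ} (γ∉T : ¬ InT γ) → π (dimVec M[ γ∉T ]) ≡ π (crossings γ)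
  π-dimVec γ∉T = cong₂ _,_ (dimension γ∉T s) (dimension γ∉T t)

  carries : ∀ {γ} (γ∉T : ¬ InT γ) {d} → ∂ (crossings γ) ≡ d → Carries d γ∉T
  carries γ∉T e = trans (sym (∂-difference (dimVec M[ γ∉T ]))) (trans (∂-dimVec γ∉T) e)

  carries⁻¹ : ∀ {γ} (γ∉T : ¬ InT γ) {d} → Carries d γ∉T → ∂ (crossings γ) ≡ d
  carries⁻¹ γ∉T e = trans (sym (∂-dimVec γ∉T)) (trans (∂-difference (dimVec M[ γ∉T ])) e)

  module _ {γ} (γ∉T : ¬ InT γ) where

    private
      indecomposable : Indecomposable M[ γ∉T ]
      indecomposable = proj₂ (exceptional γ∉T)

      defect : ∀ {d} → ∂ (crossings γ) ≡ d → ∂ (dimVec M[ γ∉T ]) ≡ d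
      defect = trans (∂-dimVec γ∉T)

      defect> : ∂ (crossings γ) ≡ 1ℤ → 0ℤ < ∂ (dimVec M[ γ∉T ])
      defect> ∂≡1 = subst (0ℤ <_) (sym (defect ∂≡1)) (ℤ.+<+ ℕ.z<s)

      defect< : ∂ (crossings γ) ≡ -1ℤ → ∂ (dimVec M[ γ∉T ]) < 0ℤ
      defect< ∂≡-1 = subst (_< 0ℤ) (sym (defect ∂≡-1)) ℤ.-<+

      irregular : ∀ {d} → ∂ (crossings γ) ≡ d → d ≢ 0ℤ → ¬ Regular M[ γ∉T ]
      irregular ∂≡d d≢0 (_ , D≡0) = d≢0 (trans (sym (defect ∂≡d)) D≡0)

      nontransjective : ∂ (crossings γ) ≡ 0ℤ → ¬ Transjective M[ γ∉T ]
      nontransjective ∂≡0 (inj₁ (_ , D<0)) = ℤₚ.<⇒≢ D<0 (defect ∂≡0)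
      nontransjective ∂≡0 (inj₂ (_ , 0<D)) = ℤₚ.<⇒≢ 0<D (sym (defect ∂≡0))

      not-carried : ∀ {d d'} → ∂ (crossings γ) ≡ d → d ≢ d' → ¬ Carries d' γ∉T
      not-carried ∂≡d d≢d' h = d≢d' (trans (sym ∂≡d) (carries⁻¹ γ∉T h))

    core-and-defect : Position γ →
      (Bridging γ ⇔ Transjective M[ γ∉T ]) ×
      (Peripheral γ ⇔ Regular M[ γ∉T ]) ×
      i⟨ γ ,core⟩ ≡ ∣ ∂ (dimVec M[ γ∉T ]) ∣ ×
      (i⟨ γ ,core⟩ ≡ 0 ⊎ i⟨ γ ,core⟩ ≡ 1)
    core-and-defect (peripheral per i≡0 ∂≡0) =
        mk⇔ (λ br → contradiction br per) (λ tr → contradiction tr (nontransjective ∂≡0))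
      , mk⇔ (λ _ → indecomposable , defect ∂≡0) (λ _ → per)
      , trans i≡0 (cong ∣_∣ (sym (defect ∂≡0)))
      , inj₁ i≡0
    core-and-defect (right br i≡1 ∂≡1) =
        mk⇔ (λ _ → inj₂ (indecomposable , defect> ∂≡1)) (λ _ → br)
      , mk⇔ (λ per → contradiction br per) (λ reg → contradiction reg (irregular ∂≡1 λ ()))
      , trans i≡1 (cong ∣_∣ (sym (defect ∂≡1)))
      , inj₂ i≡1
    core-and-defect (left br i≡1 ∂≡-1) =
        mk⇔ (λ _ → inj₁ (indecomposable , defect< ∂≡-1)) (λ _ → br)
      , mk⇔ (λ per → contradiction br per) (λ reg → contradiction reg (irregular ∂≡-1 λ ()))
      , trans i≡1 (cong ∣_∣ (sym (defect ∂≡-1)))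
      , inj₂ i≡1

    carried-by-line : Position γ →
      (Bridging γ ⇔ (Carries 1ℤ γ∉T ⊎ Carries -1ℤ γ∉T)) ×
      (Carries 1ℤ γ∉T ⇔ (Bridging γ × 0ℤ < ∂ (dimVec M[ γ∉T ]))) ×
      (Carries -1ℤ γ∉T ⇔ (Bridging γ × ∂ (dimVec M[ γ∉T ]) < 0ℤ)) ×
      (Carries 0ℤ γ∉T ⇔ i⟨ γ ,core⟩ ≡ 0)
    carried-by-line (peripheral per i≡0 ∂≡0) =
        mk⇔ (λ br → contradiction br per)
            [ (λ h → contradiction h (not-carried ∂≡0 λ ()))
            , (λ h → contradiction h (not-carried ∂≡0 λ ())) ]′
      , mk⇔ (λ h → contradiction h (not-carried ∂≡0 λ ())) (λ (br , _) → contradiction br per)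
      , mk⇔ (λ h → contradiction h (not-carried ∂≡0 λ ())) (λ (br , _) → contradiction br per)
      , mk⇔ (λ _ → i≡0) (λ _ → carries γ∉T ∂≡0)
    carried-by-line (right br i≡1 ∂≡1) =
        mk⇔ (λ _ → inj₁ (carries γ∉T ∂≡1)) (λ _ → br)
      , mk⇔ (λ _ → br , defect> ∂≡1) (λ _ → carries γ∉T ∂≡1)
      , mk⇔ (λ h → contradiction h (not-carried ∂≡1 λ ()))
            (λ (_ , D<0) → contradiction D<0 (ℤₚ.<-asym (defect> ∂≡1)))
      , mk⇔ (λ h → contradiction h (not-carried ∂≡1 λ ()))
            (λ i≡0 → contradiction (trans (sym i≡0) i≡1) λ ())
    carried-by-line (left br i≡1 ∂≡-1) =
        mk⇔ (λ _ → inj₂ (carries γ∉T ∂≡-1)) (λ _ → br)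
      , mk⇔ (λ h → contradiction h (not-carried ∂≡-1 λ ()))
            (λ (_ , 0<D) → contradiction 0<D (ℤₚ.<-asym (defect< ∂≡-1)))
      , mk⇔ (λ _ → br , defect< ∂≡-1) (λ _ → carries γ∉T ∂≡-1)
      , mk⇔ (λ h → contradiction h (not-carried ∂≡-1 λ ()))
            (λ i≡0 → contradiction (trans (sym i≡0) i≡1) λ ())

    private
      line⁺ : ∀ x {d} → ∂ (crossings γ) ≡ d → x ≗ dimVec M[ γ∉T ] → OnLine d (π x)
      line⁺ x ∂≡d x≗ = trans (cong₂ _-_ (x≗ s) (x≗ t)) (carries γ∉T ∂≡d)

      line⁻ : ∀ x {d} → ∂ (crossings γ) ≡ d → x ≗ (λ i → - dimVec M[ γ∉T ] i) →
              OnLine (- d) (π x)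
      line⁻ x {d} ∂≡d x≗ = trans (cong₂ _-_ (x≗ s) (x≗ t))
        (OnLine-neg d (dimVec M[ γ∉T ] s) (dimVec M[ γ∉T ] t) (carries γ∉T ∂≡d))

    -- A change of sign interchanges the two off-diagonal lines and preserves the diagonal, so an
    -- arc determines the line of its c-vectors only together with the sign.
    line-of : ∀ x → Position γ → x ≗ dimVec M[ γ∉T ] ⊎ x ≗ (λ i → - dimVec M[ γ∉T ] i) →
              OnLine 1ℤ (π x) ⊎ OnLine -1ℤ (π x) ⊎ OnLine 0ℤ (π x)
    line-of x (peripheral _ _ ∂≡0) (inj₁ x≗) = inj₂ (inj₂ (line⁺ x ∂≡0 x≗))
    line-of x (peripheral _ _ ∂≡0) (inj₂ x≗) = inj₂ (inj₂ (line⁻ x ∂≡0 x≗))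
    line-of x (right _ _ ∂≡1)      (inj₁ x≗) = inj₁ (line⁺ x ∂≡1 x≗)
    line-of x (right _ _ ∂≡1)      (inj₂ x≗) = inj₂ (inj₁ (line⁻ x ∂≡1 x≗))
    line-of x (left _ _ ∂≡-1)      (inj₁ x≗) = inj₂ (inj₁ (line⁺ x ∂≡-1 x≗))
    line-of x (left _ _ ∂≡-1)      (inj₂ x≗) = inj₁ (line⁻ x ∂≡-1 x≗)

  module _ {x : Fin (p ℕ.+ q) → ℤ} where

    private
      RepresentedBy± : Rep → Set
      RepresentedBy± N = x ≗ dimVec N ⊎ x ≗ (λ i → - dimVec N i)

      represented-≅ : ∀ {M N} → M ≅ N → RepresentedBy± N → RepresentedBy± M
      represented-≅ M≅N (inj₁ x≗) = inj₁ λ i → trans (x≗ i) (cong +_ (sym (_≅_.same-dim M≅N i)))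
      represented-≅ M≅N (inj₂ x≗) =
        inj₂ λ i → trans (x≗ i) (cong (λ n → - (+ n)) (sym (_≅_.same-dim M≅N i)))

      arc-of : (∃ λ N → Exceptional N × RepresentedBy± N) →
               ∃ λ γ → Σ (¬ InT γ) λ γ∉T → RepresentedBy± M[ γ∉T ]
      arc-of (N , N-exceptional , x≗±N) =
        let γ , γ∉T , M≅N = surjective N N-exceptional
        in γ , γ∉T , represented-≅ M≅N x≗±N

    cVector-arc : IsCVector Q x → ∃ λ γ → Σ (¬ InT γ) λ γ∉T →
      x ≗ dimVec M[ γ∉T ] ⊎ x ≗ (λ i → - dimVec M[ γ∉T ] i)
    cVector-arc x∈C = arc-of (Equivalence.to (cVectors x) x∈C)

  -- The two arms of a twist orbit on the off-diagonal lines

  module _ (a b : ℤ) where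

    private
      orbit : ℤ → Arc
      orbit k = twist^ k (bridging a b)

    -- The converse holds because `locate` leaves only the left arm as an alternative outside T, and
    -- there the defect is -1.
    rightArm-carried : ∀ k → firstRight a b ≤ k ⇔ Σ (¬ InT (orbit k)) (Carries 1ℤ {orbit k})
    rightArm-carried k = mk⇔
        (λ k₊≤k → let 1≤A = first≤⇒rightArm a b k k₊≤k in
          rightArm⇒∉T (a + k * + p) b 1≤A ,
          carries {orbit k} (rightArm⇒∉T (a + k * + p) b 1≤A) (∂-rightArm (a + k * + p) b 1≤A))
        (λ (γ∉T , h) → cases γ∉T h (locate (a + k * + p) b))
      where
      cases : (γ∉T : ¬ InT (orbit k)) → Carries 1ℤ {orbit k} γ∉T →
              Location (a + k * + p) b → firstRight a b ≤ k
      cases γ∉T h (inT γ∈T)      = contradiction γ∈T γ∉T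
      cases γ∉T h (rightArm 1≤A) = rightArm⇒first≤ a b k 1≤A
      cases γ∉T h (leftArm 0≤B)  = contradiction
        (trans (sym (carries⁻¹ {orbit k} γ∉T h)) (∂-leftArm (a + k * + p) b 0≤B)) λ ()

    leftArm-carried : ∀ k → k ≤ lastLeft a b ⇔ Σ (¬ InT (orbit k)) (Carries -1ℤ {orbit k})
    leftArm-carried k = mk⇔
        (λ k≤k₋ → let 0≤B = ≤last⇒leftArm a b k k≤k₋ in
          leftArm⇒∉T (a + k * + p) b 0≤B ,
          carries {orbit k} (leftArm⇒∉T (a + k * + p) b 0≤B) (∂-leftArm (a + k * + p) b 0≤B))
        (λ (γ∉T , h) → cases γ∉T h (locate (a + k * + p) b))
      where
      cases : (γ∉T : ¬ InT (orbit k)) → Carries -1ℤ {orbit k} γ∉T →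
              Location (a + k * + p) b → k ≤ lastLeft a b
      cases γ∉T h (inT γ∈T)      = contradiction γ∈T γ∉T
      cases γ∉T h (leftArm 0≤B)  = leftArm⇒≤last a b k 0≤B
      cases γ∉T h (rightArm 1≤A) = contradiction
        (trans (sym (carries⁻¹ {orbit k} γ∉T h)) (∂-rightArm (a + k * + p) b 1≤A)) λ ()

    shift-dimVec : ∀ k k' (h : ¬ InT (orbit k)) (h' : ¬ InT (orbit k')) →
      (∀ i → crossings (bridging (a + k' * + p) b) i ≡ crossings (bridging (a + k * + p) b) i + 1ℤ) →
      dimVec (M[_] {orbit k'} h') ≗ (λ i → dimVec (M[_] {orbit k} h) i + δ i)
    shift-dimVec k k' h h' e i =
      trans (dimension {orbit k'} h' i) (trans (e i) (cong (_+ 1ℤ) (sym (dimension {orbit k} h i))))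

    π-rightArm : ∀ n (h : ¬ InT (orbit (firstRight a b + + n))) →
                 π (dimVec (M[_] {orbit (firstRight a b + + n)} h)) ≡ (+ suc n , + n)
    π-rightArm n h = trans (π-dimVec {orbit (firstRight a b + + n)} h) (π-right a b n)

    π-leftArm : ∀ n (h : ¬ InT (orbit (lastLeft a b - + n))) →
                π (dimVec (M[_] {orbit (lastLeft a b - + n)} h)) ≡ (+ n , + suc n)
    π-leftArm n h = trans (π-dimVec {orbit (lastLeft a b - + n)} h) (π-left a b n)

    rightArm∉T : ∀ n → ¬ InT (orbit (firstRight a b + + n))
    rightArm∉T n = rightArm⇒∉T (a + (firstRight a b + + n) * + p) b
      (first≤⇒rightArm a b _ (ℤₚ.i≤i+j (firstRight a b) (+ n)))

    leftArm∉T : ∀ n → ¬ InT (orbit (lastLeft a b - + n))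
    leftArm∉T n = leftArm⇒∉T (a + (lastLeft a b - + n) * + p) b
      (≤last⇒leftArm a b _ (ℤₚ.i-j≤i (lastLeft a b) (+ n)))

    Attained : ℤ × ℤ → Set _
    Attained w = ∃ λ k → Σ (¬ InT (orbit k)) λ h → ∃ λ x →
      IsCVector Q x ×
      (x ≗ dimVec (M[_] {orbit k} h) ⊎ x ≗ (λ i → - dimVec (M[_] {orbit k} h) i)) ×
      π x ≡ w

    attained : ∀ k (h : ¬ InT (orbit k)) {w} → π (dimVec (M[_] {orbit k} h)) ≡ w → Attained w
    attained k h π≡w = k , h , d
        , Equivalence.from (cVectors d) (M[_] {orbit k} h , exceptional {orbit k} h , inj₁ λ _ → refl)
        , inj₁ (λ _ → refl) , π≡w
      where
      d : Fin (p ℕ.+ q) → ℤ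
      d = dimVec (M[_] {orbit k} h)

    attained-neg : ∀ k (h : ¬ InT (orbit k)) {u v} →
      π (dimVec (M[_] {orbit k} h)) ≡ (u , v) → Attained (- u , - v)
    attained-neg k h π≡w = k , h , -d
        , Equivalence.from (cVectors -d) (M[_] {orbit k} h , exceptional {orbit k} h , inj₂ λ _ → refl)
        , inj₂ (λ _ → refl) , cong (λ (u , v) → - u , - v) π≡w
      where
      -d : Fin (p ℕ.+ q) → ℤ
      -d i = - dimVec (M[_] {orbit k} h) i

    -- On the line of defect 1 the right arm supplies the points (n + 1 , n) and the negated left
    -- arm the points (-n , -(n + 1)).
    line-attained : ∀ w → OnLine 1ℤ w ⊎ OnLine -1ℤ w → Attained w
    line-attained w (inj₁ e) = cases (pointOnLine₁ w e)
      where
      cases : ∀ {w} → PointOnLine₁ w → Attained w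
      cases (positive n) =
        attained (firstRight a b + + n) (rightArm∉T n) (π-rightArm n (rightArm∉T n))
      cases (negative n) =
        attained-neg (lastLeft a b - + n) (leftArm∉T n) (π-leftArm n (leftArm∉T n))
    -- Exchanging the coordinates carries the second line to the first, with the roles of the two
    -- arms interchanged.
    line-attained (u , v) (inj₂ e) = cases (pointOnLine₁ (v , u) (OnLine-swap -1ℤ u v e))
      where
      cases : ∀ {w} → PointOnLine₁ w → Attained (swap w)
      cases (positive n) =
        attained (lastLeft a b - + n) (leftArm∉T n) (π-leftArm n (leftArm∉T n))
      cases (negative n) =
        attained-neg (firstRight a b + + n) (rightArm∉T n) (π-rightArm n (rightArm∉T n))

proposition9p1 : ∀ {c ℓ₁ ℓ₂} (K : HeytingField c ℓ₁ ℓ₂) → AlgebraicallyClosed K →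
    (p q : ℕ) .{{_ : NonZero p}} .{{_ : NonZero q}} →
    let open AnnulusModules K p q in
    (dictionary : Dictionary) → CVectorsOfQ →
    let open Dictionary dictionary in
    ( ∀ γ (γ∉T : ¬ InT γ) →
    (Bridging γ ⇔ Transjective M[ γ∉T ]) ×
    (Peripheral γ ⇔ Regular M[ γ∉T ]) ×
    i⟨ γ ,core⟩ ≡ ∣ ∂ (dimVec M[ γ∉T ]) ∣ ×
    (i⟨ γ ,core⟩ ≡ 0 ⊎ i⟨ γ ,core⟩ ≡ 1)
    ) ×
    ( (∀ γ → Peripheral γ → twist γ ≈ γ) ×
    (∀ γ → Bridging γ →
    (∀ i → VShaped (λ k → crossings (twist^ k γ) i)) ×
    ∃ λ k₀ →
    (∀ k → k₀ ℤ.≤ k →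
    crossings (twist^ (k ℤ.+ 1ℤ) γ) ≗ (λ i → crossings (twist^ k γ) i ℤ.+ δ i) ×
    ∂ (crossings (twist^ k γ)) ≡ 1ℤ) ×
    (∀ k → k ℤ.≤ ℤ.- k₀ →
    crossings (twist^ (k ℤ.- 1ℤ) γ) ≗ (λ i → crossings (twist^ k γ) i ℤ.+ δ i) ×
    ∂ (crossings (twist^ k γ)) ≡ -1ℤ))
    ) ×
    ( (∀ x → IsCVector Q x →
    (∃ λ γ → Σ (¬ InT γ) λ γ∉T →
    x ≗ dimVec M[ γ∉T ] ⊎ x ≗ (λ i → ℤ.- dimVec M[ γ∉T ] i)) ×
    (OnLine 1ℤ (π x) ⊎ OnLine -1ℤ (π x) ⊎ OnLine 0ℤ (π x))) ×
    (∀ γ (γ∉T : ¬ InT γ) →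
    (Bridging γ ⇔ (Carries 1ℤ γ∉T ⊎ Carries -1ℤ γ∉T)) ×
    (Carries 1ℤ γ∉T ⇔ (Bridging γ × 0ℤ ℤ.< ∂ (dimVec M[ γ∉T ]))) ×
    (Carries -1ℤ γ∉T ⇔ (Bridging γ × ∂ (dimVec M[ γ∉T ]) ℤ.< 0ℤ)) ×
    (Carries 0ℤ γ∉T ⇔ i⟨ γ ,core⟩ ≡ 0)) ×
    (∀ γ → Bridging γ → ∃ λ k₊ → ∃ λ k₋ → k₋ ℤ.< k₊ ×
    (∀ k → k₊ ℤ.≤ k ⇔ Σ (¬ InT (twist^ k γ)) (Carries 1ℤ)) ×
    (∀ k → k ℤ.≤ k₋ ⇔ Σ (¬ InT (twist^ k γ)) (Carries -1ℤ)) ×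
    (∀ k (h : ¬ InT (twist^ k γ)) (h' : ¬ InT (twist^ (k ℤ.+ 1ℤ) γ)) → k₊ ℤ.≤ k →
    dimVec M[ h' ] ≗ (λ i → dimVec M[ h ] i ℤ.+ δ i)) ×
    (∀ k (h : ¬ InT (twist^ k γ)) (h' : ¬ InT (twist^ (k ℤ.- 1ℤ) γ)) → k ℤ.≤ k₋ →
    dimVec M[ h' ] ≗ (λ i → dimVec M[ h ] i ℤ.+ δ i)) ×
    (∀ n (h : ¬ InT (twist^ (k₊ ℤ.+ + n) γ)) → π (dimVec M[ h ]) ≡ (+ suc n , + n)) ×
    (∀ n (h : ¬ InT (twist^ (k₋ ℤ.- + n) γ)) → π (dimVec M[ h ]) ≡ (+ n , + suc n))) ×
    (∀ γ → Bridging γ → ∀ w → OnLine 1ℤ w ⊎ OnLine -1ℤ w →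
    ∃ λ k → Σ (¬ InT (twist^ k γ)) λ h → ∃ λ x →
    IsCVector Q x ×
    (x ≗ dimVec M[ h ] ⊎ x ≗ (λ i → ℤ.- dimVec M[ h ] i)) ×
    π x ≡ w) ×
    (∃ λ (L : List Arc) → ∀ γ → i⟨ γ ,core⟩ ≡ 0 → Any (γ ≈_) L)
    )
proposition9p1 K _ p q dictionary cVectors =
    (λ γ γ∉T → core-and-defect γ∉T (position γ γ∉T))
  , ( twist-peripheral
    , λ { (bridging a b) _ → crossings-vShaped a b , orbit-arms a b })
  , (λ x x∈C →
      let γ , γ∉T , x≗± = cVector-arc x∈C
      in (γ , γ∉T , x≗±) , line-of γ∉T x (position γ γ∉T) x≗±)
  , (λ γ γ∉T → carried-by-line γ∉T (position γ γ∉T))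
  , (λ { (bridging a b) _ →
        firstRight a b , lastLeft a b , last<first a b
      , rightArm-carried a b
      , leftArm-carried a b
      , (λ k h h' k₊≤k → shift-dimVec a b k (k + 1ℤ) h h' (shift-rightArm a b k k₊≤k))
      , (λ k h h' k≤k₋ → shift-dimVec a b k (k - 1ℤ) h h' (shift-leftArm a b k k≤k₋))
      , π-rightArm a b
      , π-leftArm a b })
  , (λ { (bridging a b) _ → line-attained a b })
  , peripheralArcs , core-disjoint-finite
  where
  open AnnulusModules K p q using (bridging)
  open FanTriangulation p q
  open ExceptionalModules K p q dictionary cVectors
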